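{- Let $a,b$ and $M$ be integers satisfying $1\le a<b<\frac{M}{2}$ and $\gcd(b,M)=1$. For an integer $L\geq 0$, define $c(m,n)$ (depending on $L$) by $$\frac{1}{(zq^a,zq^{M-a};q^M)_{L}\,(1-zq^{LM+a})} - \frac{1}{(zq^b,zq^{M-b};q^M)_{L}} =: \sum_{m,n\geq 0} c(m,n)z^mq^n.$$ Then for all integers $L,m,n\geq 0$ we have $c(m,nM)\geq 0$. If in addition $M$ is even and $a$ is odd, then also $c\left(m,nM+\frac{M}{2}\right)\geq 0$ for all integers $L,m,n\geq 0$.
   Context: Notation: $(x;q)_n := \prod_{j=0}^{n-1}(1-xq^j)$ and $(x_1,\dots,x_r;q)_n := (x_1;q)_n\cdots(x_r;q)_n$, with empty products equal to $1$; thus $(zq^s,zq^t;q^M)_L=\prod_{j=0}^{L-1}(1-zq^{Mj+s})(1-zq^{Mj+t})$. Quotients are expanded as formal power series in $z$ and $q$. -}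

module Defs where

open import Data.Bool.Base using (if_then_else_; _∧_)
open import Data.Fin.Base using (Fin; zero; suc; toℕ)
open import Data.Fin.Properties using (toℕ≤pred[n])
open import Data.Integer.Base using (ℤ; 0ℤ; 1ℤ; _+_; _*_; _-_)
import Data.Integer.Properties as ℤ
open import Data.Integer.Tactic.RingSolver using (solve-∀)
open import Data.Nat.Base as ℕ using (ℕ; zero; suc; _∸_; _≡ᵇ_; z≤n; s≤s)
import Data.Nat.Properties as ℕ
open import Relation.Binary.PropositionalEquality
open ≡-Reasoning

open import Algebra.Properties.Semiring.Sum ℤ.+-*-semiring
  using (sum-syntax; sum-cong-≗; sum-replicate-zero; ∑-comm; *-distribˡ-sum)

-- The ring ℤ[[z,q]]: f m n is the coefficient of zᵐqⁿ in f.

Series : Set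
Series = ℕ → ℕ → ℤ

infixl 6 _⊖_
infixl 7 _⊛_
infixr 8 _^_
infix  8 1/_

z^_q^_ : ℕ → ℕ → Series
(z^ i q^ j) m n = if (m ≡ᵇ i) ∧ (n ≡ᵇ j) then 1ℤ else 0ℤ

𝟙 : Series
𝟙 = z^ 0 q^ 0

_⊖_ : Series → Series → Series
(f ⊖ g) m n = f m n - g m n

_⊛_ : Series → Series → Series
(f ⊛ g) m n =
  ∑[ i < suc m ] ∑[ j < suc n ] (f (toℕ i) (toℕ j) * g (m ∸ toℕ i) (n ∸ toℕ j))

_^_ : Series → ℕ → Series
f ^ zero  = 𝟙
f ^ suc k = f ⊛ f ^ k

-- The geometric expansion 1/f = Σₖ (1 - f)ᵏ, for f with constant term 1.
-- As 1 - f then has no constant term, (1 - f)ᵏ has no zᵐqⁿ term once k > m + n,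
-- so the sum may be cut off there.  It is the multiplicative inverse of f
-- by ⊛-inverse below; for other constant terms 1/ f is a junk value.

1/_ : Series → Series
(1/ f) m n = ∑[ k < suc (m ℕ.+ n) ] ((𝟙 ⊖ f) ^ toℕ k) m n

-- poch x p n = (x;p)ₙ = ∏_{j<n} (1 - x pʲ)

poch : Series → Series → ℕ → Series
poch x p zero    = 𝟙
poch x p (suc n) = poch x p n ⊛ (𝟙 ⊖ x ⊛ p ^ n)

-- poch₂ x y p n = (x,y;p)ₙ

poch₂ : Series → Series → Series → ℕ → Series
poch₂ x y p n = poch x p n ⊛ poch y p n

-- Truncated subtraction in M ∸ a and M ∸ b is only meant for a, b ≤ M.

c : (a b M L : ℕ) → Series
c a b M L =
    1/ (poch₂ (z^ 1 q^ a) (z^ 1 q^ (M ∸ a)) (z^ 0 q^ M) L ⊛ (𝟙 ⊖ z^ 1 q^ (L ℕ.* M ℕ.+ a)))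
  ⊖ 1/ (poch₂ (z^ 1 q^ b) (z^ 1 q^ (M ∸ b)) (z^ 0 q^ M) L)

private
  ∑-zero : ∀ n (f : Fin n → ℤ) → (∀ i → f i ≡ 0ℤ) → ∑[ i < n ] f i ≡ 0ℤ
  ∑-zero n f eq = trans (sum-cong-≗ eq) (sum-replicate-zero n)

  ∑-extend : ∀ {k n} (f : ℕ → ℤ) → k ℕ.≤ n → (∀ i → k ℕ.≤ i → f i ≡ 0ℤ) →
             ∑[ i < k ] f (toℕ i) ≡ ∑[ i < n ] f (toℕ i)
  ∑-extend {n = n} f z≤n f≡0 = sym (∑-zero n _ (λ i → f≡0 (toℕ i) z≤n))
  ∑-extend f (s≤s k≤n) f≡0 =
    cong (f 0 +_) (∑-extend (λ i → f (suc i)) k≤n (λ i k≤i → f≡0 (suc i) (s≤s k≤i)))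

  ∑-telescope : ∀ n (f : ℕ → ℤ) →
                ∑[ i < n ] (f (toℕ i) - f (suc (toℕ i))) ≡ f 0 - f n
  ∑-telescope zero    f = sym (ℤ.+-inverseʳ (f 0))
  ∑-telescope (suc n) f =
    trans (cong (f 0 - f 1 +_) (∑-telescope n (λ i → f (suc i))))
          (lemma (f 0) (f 1) (f (suc n)))
    where
    lemma : ∀ x y z → x - y + (y - z) ≡ x - z
    lemma = solve-∀

  ∑-distrib-- : ∀ n (f g : Fin n → ℤ) →
                ∑[ i < n ] (f i - g i) ≡ ∑[ i < n ] f i - ∑[ i < n ] g i
  ∑-distrib-- zero    f g = refl
  ∑-distrib-- (suc n) f g =
    trans (cong (f zero - g zero +_) (∑-distrib-- n (λ i → f (suc i)) (λ i → g (suc i))))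
          (lemma (f zero) (g zero) (∑[ i < n ] f (suc i)) (∑[ i < n ] g (suc i)))
    where
    lemma : ∀ x y z w → x - y + (z - w) ≡ x + z - (y + w)
    lemma = solve-∀

  ⊛-identityˡ : ∀ f m n → (𝟙 ⊛ f) m n ≡ f m n
  ⊛-identityˡ f m n = begin
    (𝟙 ⊛ f) m n           ≡⟨ cong₂ (λ x y → 1ℤ * f m n + x + y)
                             (∑-zero n _ (λ j → ℤ.*-zeroˡ (f m (n ∸ suc (toℕ j)))))
                             (∑-zero m _ (λ i → ∑-zero (suc n) _ (λ j →
                               ℤ.*-zeroˡ (f (m ∸ suc (toℕ i)) (n ∸ toℕ j))))) ⟩
    1ℤ * f m n + 0ℤ + 0ℤ  ≡⟨ lemma (f m n) ⟩
    f m n                 ∎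
    where
    lemma : ∀ x → 1ℤ * x + 0ℤ + 0ℤ ≡ x
    lemma = solve-∀

  ^-vanishes : ∀ u → u 0 0 ≡ 0ℤ → ∀ k m n → m ℕ.+ n ℕ.< k → (u ^ k) m n ≡ 0ℤ
  ^-vanishes u u₀₀ (suc k) m n (s≤s m+n≤k) =
    ∑-zero (suc m) _ (λ i → ∑-zero (suc n) _ (λ j →
      term (toℕ i) (toℕ j) (toℕ≤pred[n] i) (toℕ≤pred[n] j)))
    where
    term : ∀ i j → i ℕ.≤ m → j ℕ.≤ n → u i j * (u ^ k) (m ∸ i) (n ∸ j) ≡ 0ℤ
    term zero zero _ _ = trans (cong (_* (u ^ k) m n) u₀₀) (ℤ.*-zeroˡ ((u ^ k) m n))
    term zero (suc j) _ j<n =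
      trans (cong (u 0 (suc j) *_) (^-vanishes u u₀₀ k m (n ∸ suc j)
              (ℕ.<-≤-trans (ℕ.+-monoʳ-< m (ℕ.∸-monoʳ-< (s≤s z≤n) j<n)) m+n≤k)))
            (ℤ.*-zeroʳ (u 0 (suc j)))
    term (suc i) j i<m j≤n =
      trans (cong (u (suc i) j *_) (^-vanishes u u₀₀ k (m ∸ suc i) (n ∸ j)
              (ℕ.<-≤-trans (ℕ.+-mono-<-≤ (ℕ.∸-monoʳ-< (s≤s z≤n) i<m) (ℕ.m∸n≤m n j)) m+n≤k)))
            (ℤ.*-zeroʳ (u (suc i) j))

  ⊛-1- : ∀ f g m n → (f ⊛ g) m n ≡ g m n - ((𝟙 ⊖ f) ⊛ g) m n
  ⊛-1- f g m n = begin
    (f ⊛ g) m n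
      ≡⟨ sum-cong-≗ {suc m} (λ i → trans
           (sum-cong-≗ {suc n} (λ j → lemma (f (toℕ i) (toℕ j)) (𝟙 (toℕ i) (toℕ j))
                                          (g (m ∸ toℕ i) (n ∸ toℕ j))))
           (∑-distrib-- (suc n) (term 𝟙 i) (term (𝟙 ⊖ f) i))) ⟩
    ∑[ i < suc m ] (∑[ j < suc n ] term 𝟙 i j - ∑[ j < suc n ] term (𝟙 ⊖ f) i j)
      ≡⟨ ∑-distrib-- (suc m) (λ i → ∑[ j < suc n ] term 𝟙 i j)
                             (λ i → ∑[ j < suc n ] term (𝟙 ⊖ f) i j) ⟩
    (𝟙 ⊛ g) m n - ((𝟙 ⊖ f) ⊛ g) m n
      ≡⟨ cong (_- ((𝟙 ⊖ f) ⊛ g) m n) (⊛-identityˡ g m n) ⟩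
    g m n - ((𝟙 ⊖ f) ⊛ g) m n ∎
    where
    term : Series → Fin (suc m) → Fin (suc n) → ℤ
    term h i j = h (toℕ i) (toℕ j) * g (m ∸ toℕ i) (n ∸ toℕ j)

    lemma : ∀ x e y → x * y ≡ e * y - (e - x) * y
    lemma = solve-∀

⊛-inverse : ∀ f → f 0 0 ≡ 1ℤ → ∀ m n → (f ⊛ 1/ f) m n ≡ 𝟙 m n
⊛-inverse f f₀₀ m n = begin
  (f ⊛ 1/ f) m n
    ≡⟨ sum-cong-≗ {suc m} (λ i → sum-cong-≗ {suc n} (λ j → extend (toℕ i) (toℕ j))) ⟩
  ∑[ i < suc m ] ∑[ j < suc n ] ∑[ k < N ] t i j k
    ≡⟨ sum-cong-≗ {suc m} (λ i → ∑-comm (t i)) ⟩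
  ∑[ i < suc m ] ∑[ k < N ] ∑[ j < suc n ] t i j k
    ≡⟨ ∑-comm {suc m} {N} (λ i k → ∑[ j < suc n ] t i j k) ⟩
  ∑[ k < N ] ((f ⊛ u ^ toℕ k) m n)
    ≡⟨ sum-cong-≗ {N} (λ k → ⊛-1- f (u ^ toℕ k) m n) ⟩
  ∑[ k < N ] ((u ^ toℕ k) m n - (u ^ suc (toℕ k)) m n)
    ≡⟨ ∑-telescope N (λ k → (u ^ k) m n) ⟩
  𝟙 m n - (u ^ N) m n
    ≡⟨ cong (𝟙 m n -_) (vanishes N m n ℕ.≤-refl) ⟩
  𝟙 m n - 0ℤ
    ≡⟨ ℤ.+-identityʳ (𝟙 m n) ⟩
  𝟙 m n ∎
  where
  u : Series
  u = 𝟙 ⊖ f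

  N : ℕ
  N = suc (m ℕ.+ n)

  vanishes : ∀ k i j → i ℕ.+ j ℕ.< k → (u ^ k) i j ≡ 0ℤ
  vanishes = ^-vanishes u (cong (1ℤ -_) f₀₀)

  t : Fin (suc m) → Fin (suc n) → Fin N → ℤ
  t i j k = f (toℕ i) (toℕ j) * (u ^ toℕ k) (m ∸ toℕ i) (n ∸ toℕ j)

  extend : ∀ i j → f i j * (1/ f) (m ∸ i) (n ∸ j) ≡
                   ∑[ k < N ] (f i j * (u ^ toℕ k) (m ∸ i) (n ∸ j))
  extend i j = trans
    (cong (f i j *_) (∑-extend (λ k → (u ^ k) (m ∸ i) (n ∸ j))
      (s≤s (ℕ.+-mono-≤ (ℕ.m∸n≤m m i) (ℕ.m∸n≤m n j)))
      (λ k → vanishes k (m ∸ i) (n ∸ j))))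
    (*-distribˡ-sum {N} (f i j) (λ k → (u ^ toℕ k) (m ∸ i) (n ∸ j)))

{-# OPTIONS --safe #-}

-- Expanding both products, a factor zq^(jM±e) contributes ±e modulo M to the exponent of q.
-- Fix the numbers r ≥ s of factors of the two kinds, in either order, and put D = r - s;
-- for D = 0 the claim is clear.  As gcd(b,M) = 1, the terms with residues ±b reach the
-- prescribed class of exponents modulo M only if those with residues ±a do.  In that case
-- let x, y, y′, x′ be the quotients by M of Da, Db, D(M-b), D(M-a).  Then x ≤ y < y′ ≤ x′
-- and x + x′ = y + y′, and with t = y - x and t′ = y′ - x it suffices that
--   [L+r,r] - (q^t + q^t′) [L+r-1,r] + q^(t+t′) [L+r-1,r] ≥ 0    (Gaussian binomials).
-- As [L+r,r] is the complete homogeneous polynomial h_L(1,q,…,q^r) and t < t′ ≤ r, replacing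
-- the last binomial by the smaller [L+r-2,r] gives h_L in the powers qⁱ, i ≤ r, i ≠ t, t′.

module Submission where

open import Defs using (c)
open import Data.Integer.Base using (0ℤ; _≤_)
open import Data.Nat.Base as ℕ using (ℕ; _<_; _+_; _*_; _/_)
open import Data.Nat.Divisibility using (_∣_)
open import Data.Nat.GCD using (gcd)
open import Data.Product.Base using (_×_)
open import Relation.Binary.PropositionalEquality using (_≡_)
open import Relation.Nullary.Negation using (¬_)

open import Data.Fin.Base using (Fin; toℕ)
open import Data.Integer.Base as ℤ using (ℤ; 1ℤ)
import Data.Integer.Properties as ℤ
import Data.Integer.Tactic.RingSolver as ℤ-Solver
open import Data.List.Base using (List; []; _∷_; _++_; map; downFrom)
open import Data.List.Membership.Propositional using (_∈_)
open import Data.List.Membership.Propositional.Properties using (∈-∃++; ∈-downFrom⁺)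
open import Data.List.Properties using (++-identityʳ)
open import Data.List.Relation.Binary.Permutation.Propositional as ↭ using (_↭_; ↭-trans)
open import Data.List.Relation.Binary.Permutation.Propositional.Properties
  using (∈-resp-↭; ++-comm) renaming (shift to ↭-shift)
open import Data.List.Relation.Unary.Any using (here; there)
open import Data.Nat.Base using (zero; suc; _∸_; _%_; NonZero; >-nonZero; z≤n; s≤s)
open import Data.Nat.Coprimality as Coprime using (Coprime)
open import Data.Nat.Divisibility using (divides; ∣-trans; m∣m*n; ∣m+n∣m⇒∣n; m%n≡0⇒n∣m)
open import Data.Nat.DivMod
  using (m≡m%n+[m/n]*n; m%n<n; [m+kn]%n≡m%n; m<n⇒m%n≡m; m*n/n≡m)
import Data.Nat.Properties as ℕ
open import Data.Nat.Tactic.RingSolver using (solve-∀)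
open import Data.Product.Base using (_,_; ∃; ∃₂)
open import Data.Sum.Base using (_⊎_; inj₁; inj₂)
open import Defs using (Series; z^_q^_; 𝟙; _⊖_; _⊛_; _^_; 1/_; poch; poch₂; ⊛-inverse)
open import Function.Base using (_∘_; flip)
open import Relation.Binary.PropositionalEquality
  using (refl; sym; trans; cong; cong₂; subst; subst₂; _≢_; _≗_; module ≡-Reasoning)
open import Relation.Nullary.Decidable using (Dec; yes; no; map′)
open import Relation.Nullary.Negation using (contradiction)

open import Algebra.Properties.Semiring.Sum ℤ.+-*-semiring
  using (sum-syntax; sum-cong-≗; sum-replicate-zero; ∑-distrib-+; *-distribˡ-sum)

-- The ring of series

infix 4 _≈_
infixl 6 _⊕_

_≈_ : Series → Series → Set
f ≈ g = ∀ m n → f m n ≡ g m n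

_⊕_ : Series → Series → Series
(f ⊕ g) m n = f m n ℤ.+ g m n

⊛-congˡ : ∀ {f f′} g → f ≈ f′ → f ⊛ g ≈ f′ ⊛ g
⊛-congˡ g f≈f′ m n = sum-cong-≗ {suc m} λ i → sum-cong-≗ {suc n} λ j →
  cong (ℤ._* g (m ∸ toℕ i) (n ∸ toℕ j)) (f≈f′ (toℕ i) (toℕ j))

⊛-congʳ-upTo : ∀ f {g g′} m n → (∀ i j → i ℕ.≤ m → j ℕ.≤ n → g i j ≡ g′ i j) →
               (f ⊛ g) m n ≡ (f ⊛ g′) m n
⊛-congʳ-upTo f m n g≡g′ = sum-cong-≗ {suc m} λ i → sum-cong-≗ {suc n} λ j →
  cong (f (toℕ i) (toℕ j) ℤ.*_) (g≡g′ _ _ (ℕ.m∸n≤m m (toℕ i)) (ℕ.m∸n≤m n (toℕ j)))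

⊛-congʳ : ∀ f {g g′} → g ≈ g′ → f ⊛ g ≈ f ⊛ g′
⊛-congʳ f g≈g′ m n = ⊛-congʳ-upTo f m n λ i j _ _ → g≈g′ i j

⊛-distribʳ-⊕ : ∀ f g h → (f ⊕ g) ⊛ h ≈ f ⊛ h ⊕ g ⊛ h
⊛-distribʳ-⊕ f g h m n = begin
  ((f ⊕ g) ⊛ h) m n
    ≡⟨ (sum-cong-≗ {suc m} λ i → trans
         (sum-cong-≗ {suc n} λ j → ℤ.*-distribʳ-+ (h (m ∸ toℕ i) (n ∸ toℕ j))
           (f (toℕ i) (toℕ j)) (g (toℕ i) (toℕ j)))
         (∑-distrib-+ {suc n} (term f i) (term g i))) ⟩
  ∑[ i < suc m ] (∑[ j < suc n ] term f i j ℤ.+ ∑[ j < suc n ] term g i j)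
    ≡⟨ ∑-distrib-+ {suc m} (λ i → ∑[ j < suc n ] term f i j) (λ i → ∑[ j < suc n ] term g i j) ⟩
  (f ⊛ h ⊕ g ⊛ h) m n ∎
  where
  open ≡-Reasoning
  term : Series → Fin (suc m) → Fin (suc n) → ℤ
  term k i j = k (toℕ i) (toℕ j) ℤ.* h (m ∸ toℕ i) (n ∸ toℕ j)

⊛-distribʳ-⊖ : ∀ f g h → (f ⊖ g) ⊛ h ≈ f ⊛ h ⊖ g ⊛ h
⊛-distribʳ-⊖ f g h m n = begin
  ((f ⊖ g) ⊛ h) m n
    ≡⟨ lemma₁ (((f ⊖ g) ⊛ h) m n) ((g ⊛ h) m n) ⟩
  ((f ⊖ g) ⊛ h ⊕ g ⊛ h) m n ℤ.- (g ⊛ h) m n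
    ≡⟨ cong (ℤ._- (g ⊛ h) m n) (⊛-distribʳ-⊕ (f ⊖ g) g h m n) ⟨
  ((f ⊖ g ⊕ g) ⊛ h) m n ℤ.- (g ⊛ h) m n
    ≡⟨ cong (ℤ._- (g ⊛ h) m n) (⊛-congˡ h (λ i j → lemma₂ (f i j) (g i j)) m n) ⟩
  (f ⊛ h ⊖ g ⊛ h) m n ∎
  where
  open ≡-Reasoning
  lemma₁ : ∀ x y → x ≡ x ℤ.+ y ℤ.- y
  lemma₁ = ℤ-Solver.solve-∀
  lemma₂ : ∀ x y → x ℤ.- y ℤ.+ y ≡ x
  lemma₂ = ℤ-Solver.solve-∀

-- Multiplication by z and by q, and induction on exponents

z· q· : Series → Series
z· f zero    n = 0ℤ
z· f (suc m) n = f m n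
q· f m zero    = 0ℤ
q· f m (suc n) = f m n

z·-cong : ∀ {f g} → f ≈ g → z· f ≈ z· g
z·-cong f≈g zero    n = refl
z·-cong f≈g (suc m) n = f≈g m n

q·-cong : ∀ {f g} → f ≈ g → q· f ≈ q· g
q·-cong f≈g m zero    = refl
q·-cong f≈g m (suc n) = f≈g m n

∑-zero : ∀ n (f : Fin n → ℤ) → (∀ i → f i ≡ 0ℤ) → ∑[ i < n ] f i ≡ 0ℤ
∑-zero n f f≡0 = trans (sum-cong-≗ f≡0) (sum-replicate-zero n)

z·-⊛ : ∀ f g → z· f ⊛ g ≈ z· (f ⊛ g)
z·-⊛ f g zero    n = trans (ℤ.+-identityʳ _) (∑-zero (suc n) _ λ j → ℤ.*-zeroˡ (g zero (n ∸ toℕ j)))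
z·-⊛ f g (suc m) n = trans
  (cong (ℤ._+ (f ⊛ g) m n) (∑-zero (suc n) _ λ j → ℤ.*-zeroˡ (g (suc m) (n ∸ toℕ j))))
  (ℤ.+-identityˡ _)

q·-⊛ : ∀ f g → q· f ⊛ g ≈ q· (f ⊛ g)
q·-⊛ f g m zero    = ∑-zero (suc m) _ λ i →
  trans (ℤ.+-identityʳ _) (ℤ.*-zeroˡ (g (m ∸ toℕ i) zero))
q·-⊛ f g m (suc n) = sum-cong-≗ {suc m} {λ i → 0ℤ ℤ.* g (m ∸ toℕ i) (suc n) ℤ.+ row i} {row} λ i → trans
  (cong (ℤ._+ row i) (ℤ.*-zeroˡ (g (m ∸ toℕ i) (suc n))))
  (ℤ.+-identityˡ (row i))
  where
  row : Fin (suc m) → ℤ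
  row i = ∑[ j < suc n ] (f (toℕ i) (toℕ j) ℤ.* g (m ∸ toℕ i) (n ∸ toℕ j))

constant : ℤ → Series
constant k zero    zero    = k
constant k _       _       = 0ℤ

constant-⊛ : ∀ k g m n → (constant k ⊛ g) m n ≡ k ℤ.* g m n
constant-⊛ k g m n = begin
  (constant k ⊛ g) m n
    ≡⟨ cong₂ (λ x y → k ℤ.* g m n ℤ.+ x ℤ.+ y)
         (∑-zero n _ λ j → ℤ.*-zeroˡ (g m (n ∸ suc (toℕ j))))
         (∑-zero m _ λ i → ∑-zero (suc n) _ λ j → ℤ.*-zeroˡ (g (m ∸ suc (toℕ i)) (n ∸ toℕ j))) ⟩
  k ℤ.* g m n ℤ.+ 0ℤ ℤ.+ 0ℤ
    ≡⟨ lemma (k ℤ.* g m n) ⟩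
  k ℤ.* g m n ∎
  where
  open ≡-Reasoning
  lemma : ∀ x → x ℤ.+ 0ℤ ℤ.+ 0ℤ ≡ x
  lemma = ℤ-Solver.solve-∀

-- Every monomial divisible by z is assigned to `tail-z`, so `tail-q` keeps only the row of z⁰ and
-- no term is counted twice in `decompose`.
tail-q tail-z : Series → Series
tail-q f zero    n = f zero (suc n)
tail-q f (suc m) n = 0ℤ
tail-z f m n = f (suc m) n

decompose : ∀ f → f ≈ constant (f 0 0) ⊕ q· (tail-q f) ⊕ z· (tail-z f)
decompose f zero    zero    = lemma (f 0 0)
  where
  lemma : ∀ x → x ≡ x ℤ.+ 0ℤ ℤ.+ 0ℤ
  lemma = ℤ-Solver.solve-∀
decompose f zero    (suc n) = lemma (f 0 (suc n))
  where
  lemma : ∀ x → x ≡ 0ℤ ℤ.+ x ℤ.+ 0ℤ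
  lemma = ℤ-Solver.solve-∀
decompose f (suc m) zero    = sym (ℤ.+-identityˡ _)
decompose f (suc m) (suc n) = sym (ℤ.+-identityˡ _)

-- A recursion for the convolution: `q·` and `z·` refer only to smaller exponents, so identities
-- between products can be proved by induction on m and n instead of by reindexing sums.
⊛-unfold : ∀ f g m n →
  (f ⊛ g) m n ≡ f 0 0 ℤ.* g m n ℤ.+ q· (tail-q f ⊛ g) m n ℤ.+ z· (tail-z f ⊛ g) m n
⊛-unfold f g m n = begin
  (f ⊛ g) m n
    ≡⟨ ⊛-congˡ g (decompose f) m n ⟩
  ((constant (f 0 0) ⊕ q· (tail-q f) ⊕ z· (tail-z f)) ⊛ g) m n
    ≡⟨ ⊛-distribʳ-⊕ (constant (f 0 0) ⊕ q· (tail-q f)) (z· (tail-z f)) g m n ⟩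
  ((constant (f 0 0) ⊕ q· (tail-q f)) ⊛ g ⊕ z· (tail-z f) ⊛ g) m n
    ≡⟨ cong₂ ℤ._+_ (⊛-distribʳ-⊕ (constant (f 0 0)) (q· (tail-q f)) g m n) (z·-⊛ (tail-z f) g m n) ⟩
  (constant (f 0 0) ⊛ g ⊕ q· (tail-q f) ⊛ g ⊕ z· (tail-z f ⊛ g)) m n
    ≡⟨ cong₂ (λ x y → x ℤ.+ y ℤ.+ z· (tail-z f ⊛ g) m n)
         (constant-⊛ (f 0 0) g m n) (q·-⊛ (tail-q f) g m n) ⟩
  f 0 0 ℤ.* g m n ℤ.+ q· (tail-q f ⊛ g) m n ℤ.+ z· (tail-z f ⊛ g) m n ∎
  where open ≡-Reasoning

-- Unfolding f leaves a scalar multiple, which associates termwise, and two products with one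
-- exponent lowered, to which induction applies.
⊛-assoc : ∀ f g h → (f ⊛ g) ⊛ h ≈ f ⊛ (g ⊛ h)
⊛-assoc f g h m n = begin
  ((f ⊛ g) ⊛ h) m n
    ≡⟨ ⊛-congˡ h (λ i j → trans (⊛-unfold f g i j)
         (cong (λ x → x ℤ.+ q· (tail-q f ⊛ g) i j ℤ.+ z· (tail-z f ⊛ g) i j)
               (sym (constant-⊛ (f 0 0) g i j)))) m n ⟩
  ((constant (f 0 0) ⊛ g ⊕ q· (tail-q f ⊛ g) ⊕ z· (tail-z f ⊛ g)) ⊛ h) m n
    ≡⟨ ⊛-distribʳ-⊕ (constant (f 0 0) ⊛ g ⊕ q· (tail-q f ⊛ g)) (z· (tail-z f ⊛ g)) h m n ⟩
  ((constant (f 0 0) ⊛ g ⊕ q· (tail-q f ⊛ g)) ⊛ h ⊕ z· (tail-z f ⊛ g) ⊛ h) m n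
    ≡⟨ cong₂ ℤ._+_ (⊛-distribʳ-⊕ (constant (f 0 0) ⊛ g) (q· (tail-q f ⊛ g)) h m n)
                   (z·-⊛ (tail-z f ⊛ g) h m n) ⟩
  ((constant (f 0 0) ⊛ g) ⊛ h ⊕ q· (tail-q f ⊛ g) ⊛ h ⊕ z· ((tail-z f ⊛ g) ⊛ h)) m n
    ≡⟨ cong₂ ℤ._+_ (cong₂ ℤ._+_ scalar (trans (q·-⊛ (tail-q f ⊛ g) h m n) (q-step n))) (z-step m) ⟩
  f 0 0 ℤ.* (g ⊛ h) m n ℤ.+ q· (tail-q f ⊛ (g ⊛ h)) m n ℤ.+ z· (tail-z f ⊛ (g ⊛ h)) m n
    ≡⟨ ⊛-unfold f (g ⊛ h) m n ⟨
  (f ⊛ (g ⊛ h)) m n ∎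
  where
  open ≡-Reasoning
  term : Fin (suc m) → Fin (suc n) → ℤ
  term i j = g (toℕ i) (toℕ j) ℤ.* h (m ∸ toℕ i) (n ∸ toℕ j)
  scalar : ((constant (f 0 0) ⊛ g) ⊛ h) m n ≡ f 0 0 ℤ.* (g ⊛ h) m n
  scalar = begin
    ((constant (f 0 0) ⊛ g) ⊛ h) m n
      ≡⟨ (sum-cong-≗ {suc m} λ i → trans
           (sum-cong-≗ {suc n} λ j → trans
             (cong (ℤ._* h (m ∸ toℕ i) (n ∸ toℕ j)) (constant-⊛ (f 0 0) g (toℕ i) (toℕ j)))
             (ℤ.*-assoc (f 0 0) (g (toℕ i) (toℕ j)) (h (m ∸ toℕ i) (n ∸ toℕ j))))
           (sym (*-distribˡ-sum {suc n} (f 0 0) (term i)))) ⟩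
    ∑[ i < suc m ] (f 0 0 ℤ.* ∑[ j < suc n ] term i j)
      ≡⟨ *-distribˡ-sum {suc m} (f 0 0) (λ i → ∑[ j < suc n ] term i j) ⟨
    f 0 0 ℤ.* (g ⊛ h) m n ∎
  q-step : ∀ n → q· ((tail-q f ⊛ g) ⊛ h) m n ≡ q· (tail-q f ⊛ (g ⊛ h)) m n
  q-step zero    = refl
  q-step (suc n) = ⊛-assoc (tail-q f) g h m n
  z-step : ∀ m → z· ((tail-z f ⊛ g) ⊛ h) m n ≡ z· (tail-z f ⊛ (g ⊛ h)) m n
  z-step zero    = refl
  z-step (suc m) = ⊛-assoc (tail-z f) g h m n

-- As the constant term of f is 1, the unfolded product can be solved for `g m n` in terms of
-- coefficients of g of smaller total degree; the bound k carries this strong induction.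
⊛-cancelˡ : ∀ f g g′ → f 0 0 ≡ 1ℤ → f ⊛ g ≈ f ⊛ g′ → g ≈ g′
⊛-cancelˡ f g g′ f₀₀ eq m n = go (suc (m + n)) m n ℕ.≤-refl
  where
  open ≡-Reasoning
  lemma : ∀ x y z → x ≡ 1ℤ ℤ.* x ℤ.+ y ℤ.+ z ℤ.- y ℤ.- z
  lemma = ℤ-Solver.solve-∀
  go : ∀ k m n → m + n ℕ.< k → g m n ≡ g′ m n
  go (suc k) m n (s≤s m+n≤k) = begin
    g m n
      ≡⟨ expand g ⟩
    (f ⊛ g) m n ℤ.- q· (tail-q f ⊛ g) m n ℤ.- z· (tail-z f ⊛ g) m n
      ≡⟨ cong₂ ℤ._-_ (cong₂ ℤ._-_ (eq m n) (q-step n m+n≤k)) (z-step m m+n≤k) ⟩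
    (f ⊛ g′) m n ℤ.- q· (tail-q f ⊛ g′) m n ℤ.- z· (tail-z f ⊛ g′) m n
      ≡⟨ expand g′ ⟨
    g′ m n ∎
    where
    expand : ∀ h → h m n ≡ (f ⊛ h) m n ℤ.- q· (tail-q f ⊛ h) m n ℤ.- z· (tail-z f ⊛ h) m n
    expand h = trans (lemma (h m n) (q· (tail-q f ⊛ h) m n) (z· (tail-z f ⊛ h) m n))
      (cong (λ x → x ℤ.- q· (tail-q f ⊛ h) m n ℤ.- z· (tail-z f ⊛ h) m n)
        (trans (cong (λ x → x ℤ.* h m n ℤ.+ q· (tail-q f ⊛ h) m n ℤ.+ z· (tail-z f ⊛ h) m n) (sym f₀₀))
               (sym (⊛-unfold f h m n))))
    q-step : ∀ n → m + n ℕ.≤ k → q· (tail-q f ⊛ g) m n ≡ q· (tail-q f ⊛ g′) m n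
    q-step zero    _     = refl
    q-step (suc n) m+n<k = ⊛-congʳ-upTo (tail-q f) m n λ i j i≤m j≤n → go k i j
      (ℕ.≤-<-trans (ℕ.+-mono-≤ i≤m j≤n) (subst (ℕ._≤ k) (ℕ.+-suc m n) m+n<k))
    z-step : ∀ m → m + n ℕ.≤ k → z· (tail-z f ⊛ g) m n ≡ z· (tail-z f ⊛ g′) m n
    z-step zero    _     = refl
    z-step (suc m) m+n<k = ⊛-congʳ-upTo (tail-z f) m n λ i j i≤m j≤n → go k i j
      (ℕ.≤-<-trans (ℕ.+-mono-≤ i≤m j≤n) m+n<k)

-- Allows a reciprocal to be guessed and checked by multiplication, without opening the geometric
-- sum.
1/-unique : ∀ f g → f 0 0 ≡ 1ℤ → f ⊛ g ≈ 𝟙 → 1/ f ≈ g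
1/-unique f g f₀₀ fg≈𝟙 = ⊛-cancelˡ f (1/ f) g f₀₀ λ m n →
  trans (⊛-inverse f f₀₀ m n) (sym (fg≈𝟙 m n))

-- Products and powers of monomials

q·-monomial : ∀ i j → q· (z^ i q^ j) ≈ z^ i q^ suc j
q·-monomial zero    j zero    zero    = refl
q·-monomial zero    j zero    (suc n) = refl
q·-monomial zero    j (suc m) zero    = refl
q·-monomial zero    j (suc m) (suc n) = refl
q·-monomial (suc i) j zero    zero    = refl
q·-monomial (suc i) j zero    (suc n) = refl
q·-monomial (suc i) j (suc m) zero    = q·-monomial i j m zero
q·-monomial (suc i) j (suc m) (suc n) = q·-monomial i j m (suc n)

z·-monomial : ∀ i j → z· (z^ i q^ j) ≈ z^ suc i q^ j
z·-monomial i j zero    n = refl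
z·-monomial i j (suc m) n = refl

monomial-suc-q-⊛ : ∀ i j g → z^ i q^ suc j ⊛ g ≈ q· (z^ i q^ j ⊛ g)
monomial-suc-q-⊛ i j g m n =
  trans (sym (⊛-congˡ g (q·-monomial i j) m n)) (q·-⊛ (z^ i q^ j) g m n)

monomial-suc-z-⊛ : ∀ i j g → z^ suc i q^ j ⊛ g ≈ z· (z^ i q^ j ⊛ g)
monomial-suc-z-⊛ i j g m n =
  trans (sym (⊛-congˡ g (z·-monomial i j) m n)) (z·-⊛ (z^ i q^ j) g m n)

⊛-identityˡ : ∀ g → 𝟙 ⊛ g ≈ g
⊛-identityˡ g m n = begin
  (𝟙 ⊛ g) m n          ≡⟨ ⊛-congˡ g 𝟙≈constant m n ⟩
  (constant 1ℤ ⊛ g) m n ≡⟨ constant-⊛ 1ℤ g m n ⟩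
  1ℤ ℤ.* g m n          ≡⟨ ℤ.*-identityˡ (g m n) ⟩
  g m n                 ∎
  where
  open ≡-Reasoning
  𝟙≈constant : 𝟙 ≈ constant 1ℤ
  𝟙≈constant zero    zero    = refl
  𝟙≈constant zero    (suc n) = refl
  𝟙≈constant (suc m) n       = refl

monomial-⊛ : ∀ i j k l → z^ i q^ j ⊛ z^ k q^ l ≈ z^ (i + k) q^ (j + l)
monomial-⊛ zero    zero    k l m n = ⊛-identityˡ (z^ k q^ l) m n
monomial-⊛ zero    (suc j) k l m n = begin
  (z^ 0 q^ suc j ⊛ z^ k q^ l) m n   ≡⟨ monomial-suc-q-⊛ 0 j (z^ k q^ l) m n ⟩
  q· (z^ 0 q^ j ⊛ z^ k q^ l) m n    ≡⟨ q·-cong (monomial-⊛ 0 j k l) m n ⟩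
  q· (z^ k q^ (j + l)) m n        ≡⟨ q·-monomial k (j + l) m n ⟩
  (z^ k q^ suc (j + l)) m n       ∎
  where open ≡-Reasoning
monomial-⊛ (suc i) j       k l m n = begin
  (z^ suc i q^ j ⊛ z^ k q^ l) m n   ≡⟨ monomial-suc-z-⊛ i j (z^ k q^ l) m n ⟩
  z· (z^ i q^ j ⊛ z^ k q^ l) m n    ≡⟨ z·-cong (monomial-⊛ i j k l) m n ⟩
  z· (z^ (i + k) q^ (j + l)) m n ≡⟨ z·-monomial (i + k) (j + l) m n ⟩
  (z^ suc (i + k) q^ (j + l)) m n ∎
  where open ≡-Reasoning

q-power : ∀ M n → (z^ 0 q^ M) ^ n ≈ z^ 0 q^ (n * M)
q-power M zero    i j = refl
q-power M (suc n) i j = trans (⊛-congʳ (z^ 0 q^ M) (q-power M n) i j) (monomial-⊛ 0 M 0 (n * M) i j)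

-- Complete homogeneous polynomials in powers of q

-- Multiplication by qᵏ on power series in q alone. Their coefficients are natural numbers, so that
-- positivity is built in and inequalities can be compared termwise.
shift : ℕ → (ℕ → ℕ) → ℕ → ℕ
shift zero    f n       = f n
shift (suc k) f zero    = 0
shift (suc k) f (suc n) = shift k f n

shift-cong : ∀ k {f g} → f ≗ g → shift k f ≗ shift k g
shift-cong zero    f≗g n       = f≗g n
shift-cong (suc k) f≗g zero    = refl
shift-cong (suc k) f≗g (suc n) = shift-cong k f≗g n

shift-mono : ∀ k {f g} → (∀ n → f n ℕ.≤ g n) → ∀ n → shift k f n ℕ.≤ shift k g n
shift-mono zero    f≤g n       = f≤g n
shift-mono (suc k) f≤g zero    = z≤n
shift-mono (suc k) f≤g (suc n) = shift-mono k f≤g n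

shift-0 : ∀ k n → shift k (λ _ → 0) n ≡ 0
shift-0 zero    n       = refl
shift-0 (suc k) zero    = refl
shift-0 (suc k) (suc n) = shift-0 k n

shift-+ : ∀ k f g n → shift k (λ i → f i + g i) n ≡ shift k f n + shift k g n
shift-+ zero    f g n       = refl
shift-+ (suc k) f g zero    = refl
shift-+ (suc k) f g (suc n) = shift-+ k f g n

shift-∘ : ∀ j k f → shift j (shift k f) ≗ shift (j + k) f
shift-∘ zero    k f n       = refl
shift-∘ (suc j) k f zero    = refl
shift-∘ (suc j) k f (suc n) = shift-∘ j k f n

shift-comm : ∀ j k f → shift j (shift k f) ≗ shift k (shift j f)
shift-comm j k f n = begin
  shift j (shift k f) n ≡⟨ shift-∘ j k f n ⟩
  shift (j + k) f n     ≡⟨ cong (λ i → shift i f n) (ℕ.+-comm j k) ⟩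
  shift (k + j) f n     ≡⟨ shift-∘ k j f n ⟨
  shift k (shift j f) n ∎
  where open ≡-Reasoning

shift-< : ∀ {k n} f → n < k → shift k f n ≡ 0
shift-< {suc k} {zero}  f _         = refl
shift-< {suc k} {suc n} f (s≤s n<k) = shift-< f n<k

shift-cancel : ∀ i k f n → shift (i + k) f (i + n) ≡ shift k f n
shift-cancel zero    k f n = refl
shift-cancel (suc i) k f n = shift-cancel i k f n

-- hom xs m f is the product of f, as a power series in q, with the complete
-- homogeneous symmetric polynomial of degree m evaluated at the powers qˣ, x ∈ xs.

hom : List ℕ → ℕ → (ℕ → ℕ) → ℕ → ℕ
hom xs       zero    f n = f n
hom []       (suc m) f n = 0
hom (x ∷ xs) (suc m) f n = hom xs (suc m) f n + shift x (hom (x ∷ xs) m f) n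

hom-cong : ∀ xs m {f g} → f ≗ g → hom xs m f ≗ hom xs m g
hom-cong xs       zero    f≗g n = f≗g n
hom-cong []       (suc m) f≗g n = refl
hom-cong (x ∷ xs) (suc m) f≗g n =
  cong₂ _+_ (hom-cong xs (suc m) f≗g n) (shift-cong x (hom-cong (x ∷ xs) m f≗g) n)

hom-0 : ∀ xs m n → hom xs m (λ _ → 0) n ≡ 0
hom-0 xs       zero    n = refl
hom-0 []       (suc m) n = refl
hom-0 (x ∷ xs) (suc m) n =
  cong₂ _+_ (hom-0 xs (suc m) n) (trans (shift-cong x (hom-0 (x ∷ xs) m) n) (shift-0 x n))

interchange : ∀ a b c d → (a + b) + (c + d) ≡ (a + c) + (b + d)
interchange = solve-∀

hom-+ : ∀ xs m f g n → hom xs m (λ i → f i + g i) n ≡ hom xs m f n + hom xs m g n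
hom-+ xs       zero    f g n = refl
hom-+ []       (suc m) f g n = refl
hom-+ (x ∷ xs) (suc m) f g n = trans
  (cong₂ _+_ (hom-+ xs (suc m) f g n)
    (trans (shift-cong x (hom-+ (x ∷ xs) m f g) n)
           (shift-+ x (hom (x ∷ xs) m f) (hom (x ∷ xs) m g) n)))
  (interchange (hom xs (suc m) f n) (hom xs (suc m) g n)
    (shift x (hom (x ∷ xs) m f) n) (shift x (hom (x ∷ xs) m g) n))

hom-shift : ∀ xs m k f → hom xs m (shift k f) ≗ shift k (hom xs m f)
hom-shift xs       zero    k f n = refl
hom-shift []       (suc m) k f n = sym (shift-0 k n)
hom-shift (x ∷ xs) (suc m) k f n = begin
  hom xs (suc m) (shift k f) n + shift x (hom (x ∷ xs) m (shift k f)) n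
    ≡⟨ cong₂ _+_ (hom-shift xs (suc m) k f n)
         (trans (shift-cong x (hom-shift (x ∷ xs) m k f) n) (shift-comm x k (hom (x ∷ xs) m f) n)) ⟩
  shift k (hom xs (suc m) f) n + shift k (shift x (hom (x ∷ xs) m f)) n
    ≡⟨ shift-+ k (hom xs (suc m) f) (shift x (hom (x ∷ xs) m f)) n ⟨
  shift k (hom (x ∷ xs) (suc m) f) n ∎
  where open ≡-Reasoning

-- Both operators are multiplications by polynomials in q.
hom-comm : ∀ xs ys m k f → hom xs m (hom ys k f) ≗ hom ys k (hom xs m f)
hom-comm xs       ys zero    k f n = refl
hom-comm []       ys (suc m) k f n = sym (hom-0 ys k n)
hom-comm (x ∷ xs) ys (suc m) k f n = begin
  hom xs (suc m) (hom ys k f) n + shift x (hom (x ∷ xs) m (hom ys k f)) n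
    ≡⟨ cong₂ _+_ (hom-comm xs ys (suc m) k f n)
         (trans (shift-cong x (hom-comm (x ∷ xs) ys m k f) n)
                (sym (hom-shift ys k x (hom (x ∷ xs) m f) n))) ⟩
  hom ys k (hom xs (suc m) f) n + hom ys k (shift x (hom (x ∷ xs) m f)) n
    ≡⟨ hom-+ ys k (hom xs (suc m) f) (shift x (hom (x ∷ xs) m f)) n ⟨
  hom ys k (hom (x ∷ xs) (suc m) f) n ∎
  where open ≡-Reasoning

-- The terms free of qˣ and qʸ agree at once. In the rest, induction on the degree lets either
-- exponent be unfolded first, and one more unfolding makes the expression symmetric in x and y.
hom-swap : ∀ x y xs m f → hom (x ∷ y ∷ xs) m f ≗ hom (y ∷ x ∷ xs) m f
hom-swap x y xs zero    f n = refl
hom-swap x y xs (suc m) f n = begin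
  a + shift y (hom (y ∷ xs) m f) n + shift x (hom (x ∷ y ∷ xs) m f) n
    ≡⟨ ℕ.+-assoc a _ _ ⟩
  a + (shift y (hom (y ∷ xs) m f) n + shift x (hom (x ∷ y ∷ xs) m f) n)
    ≡⟨ cong (a +_) (rest m) ⟩
  a + (shift x (hom (x ∷ xs) m f) n + shift y (hom (y ∷ x ∷ xs) m f) n)
    ≡⟨ ℕ.+-assoc a _ _ ⟨
  a + shift x (hom (x ∷ xs) m f) n + shift y (hom (y ∷ x ∷ xs) m f) n ∎
  where
  open ≡-Reasoning
  a = hom xs (suc m) f n
  rest : ∀ m → shift y (hom (y ∷ xs) m f) n + shift x (hom (x ∷ y ∷ xs) m f) n ≡
               shift x (hom (x ∷ xs) m f) n + shift y (hom (y ∷ x ∷ xs) m f) n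
  rest zero    = ℕ.+-comm (shift y f n) _
  rest (suc m) = begin
    shift y (hom (y ∷ xs) (suc m) f) n + shift x (hom (x ∷ y ∷ xs) (suc m) f) n
      ≡⟨ cong (shift y (hom (y ∷ xs) (suc m) f) n +_)
           (trans (shift-cong x (hom-swap x y xs (suc m) f) n)
                  (shift-+ x (hom (x ∷ xs) (suc m) f) (shift y (hom (y ∷ x ∷ xs) m f)) n)) ⟩
    shift y (hom (y ∷ xs) (suc m) f) n +
      (shift x (hom (x ∷ xs) (suc m) f) n + shift x (shift y (hom (y ∷ x ∷ xs) m f)) n)
      ≡⟨ cong (λ w → shift y (hom (y ∷ xs) (suc m) f) n + (shift x (hom (x ∷ xs) (suc m) f) n + w))
           (trans (shift-comm x y (hom (y ∷ x ∷ xs) m f) n)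
             (shift-cong y (shift-cong x (sym ∘ hom-swap x y xs m f)) n)) ⟩
    shift y (hom (y ∷ xs) (suc m) f) n +
      (shift x (hom (x ∷ xs) (suc m) f) n + shift y (shift x (hom (x ∷ y ∷ xs) m f)) n)
      ≡⟨ rearrange (shift y (hom (y ∷ xs) (suc m) f) n) (shift x (hom (x ∷ xs) (suc m) f) n) _ ⟩
    shift x (hom (x ∷ xs) (suc m) f) n +
      (shift y (hom (y ∷ xs) (suc m) f) n + shift y (shift x (hom (x ∷ y ∷ xs) m f)) n)
      ≡⟨ cong (shift x (hom (x ∷ xs) (suc m) f) n +_)
           (trans (shift-cong y (sym ∘ hom-swap x y xs (suc m) f) n)
                  (shift-+ y (hom (y ∷ xs) (suc m) f) (shift x (hom (x ∷ y ∷ xs) m f)) n)) ⟨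
    shift x (hom (x ∷ xs) (suc m) f) n + shift y (hom (y ∷ x ∷ xs) (suc m) f) n ∎
    where
    rearrange : ∀ p q r → p + (q + r) ≡ q + (p + r)
    rearrange = solve-∀

hom-prep : ∀ x {xs ys} → (∀ m f → hom xs m f ≗ hom ys m f) →
           ∀ m f → hom (x ∷ xs) m f ≗ hom (x ∷ ys) m f
hom-prep x eq zero    f n = refl
hom-prep x eq (suc m) f n = cong₂ _+_ (eq (suc m) f n) (shift-cong x (hom-prep x eq m f) n)

hom-↭ : ∀ {xs ys} → xs ↭ ys → ∀ m f → hom xs m f ≗ hom ys m f
hom-↭ ↭.refl         m f n = refl
hom-↭ (↭.prep x p)   m f n = hom-prep x (hom-↭ p) m f n
hom-↭ (↭.swap x y p) m f n =
  trans (hom-swap x y _ m f n) (hom-prep y (hom-prep x (hom-↭ p)) m f n)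
hom-↭ (↭.trans p q)  m f n = trans (hom-↭ p m f n) (hom-↭ q m f n)

-- Sums over all pairs with r + s = m

anti : (ℕ → ℕ → ℕ) → ℕ → ℕ
anti F zero    = F 0 0
anti F (suc m) = F 0 (suc m) + anti (F ∘ suc) m

anti-cong : ∀ {F G : ℕ → ℕ → ℕ} → (∀ r s → F r s ≡ G r s) → anti F ≗ anti G
anti-cong F≡G zero    = F≡G 0 0
anti-cong F≡G (suc m) = cong₂ _+_ (F≡G 0 (suc m)) (anti-cong (F≡G ∘ suc) m)

anti-mono : ∀ {F G : ℕ → ℕ → ℕ} → (∀ r s → F r s ℕ.≤ G r s) → ∀ m → anti F m ℕ.≤ anti G m
anti-mono F≤G zero    = F≤G 0 0
anti-mono F≤G (suc m) = ℕ.+-mono-≤ (F≤G 0 (suc m)) (anti-mono (F≤G ∘ suc) m)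

anti-+ : ∀ F G m → anti (λ r s → F r s + G r s) m ≡ anti F m + anti G m
anti-+ F G zero    = refl
anti-+ F G (suc m) = trans (cong (F 0 (suc m) + G 0 (suc m) +_) (anti-+ (F ∘ suc) (G ∘ suc) m))
  (interchange (F 0 (suc m)) (G 0 (suc m)) (anti (F ∘ suc) m) (anti (G ∘ suc) m))

anti-last : ∀ F m → anti F (suc m) ≡ anti (λ r s → F r (suc s)) m + F (suc m) 0
anti-last F zero    = refl
anti-last F (suc m) = trans (cong (F 0 (suc (suc m)) +_) (anti-last (F ∘ suc) m))
  (sym (ℕ.+-assoc (F 0 (suc (suc m))) _ _))

anti-flip : ∀ F → anti (flip F) ≗ anti F
anti-flip F zero    = refl
anti-flip F (suc m) = begin
  F (suc m) 0 + anti (λ r s → F s (suc r)) m ≡⟨ cong (F (suc m) 0 +_) (anti-flip (λ r s → F r (suc s)) m) ⟩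
  F (suc m) 0 + anti (λ r s → F r (suc s)) m ≡⟨ ℕ.+-comm (F (suc m) 0) _ ⟩
  anti (λ r s → F r (suc s)) m + F (suc m) 0 ≡⟨ anti-last F m ⟨
  anti F (suc m) ∎
  where open ≡-Reasoning

-- Exchanging r and s preserves the sum, so twice the sum is the sum of the symmetrised terms. This
-- fits `count-inequality`, which compares the terms in pairs.
anti-mono-symmetrised : ∀ {F G : ℕ → ℕ → ℕ} → (∀ r s → F r s + F s r ℕ.≤ G r s + G s r) →
                        ∀ m → anti F m ℕ.≤ anti G m
anti-mono-symmetrised {F} {G} F≤G m =
  ℕ.*-cancelˡ-≤ 2 (subst₂ ℕ._≤_ (double F) (double G) (anti-mono F≤G m))
  where
  open ≡-Reasoning
  double : ∀ F → anti (λ r s → F r s + F s r) m ≡ 2 * anti F m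
  double F = begin
    anti (λ r s → F r s + F s r) m ≡⟨ anti-+ F (flip F) m ⟩
    anti F m + anti (flip F) m     ≡⟨ cong (anti F m +_) (anti-flip F m) ⟩
    anti F m + anti F m            ≡⟨ cong (anti F m +_) (ℕ.+-identityʳ (anti F m)) ⟨
    2 * anti F m                   ∎

shift-anti : ∀ k (F : ℕ → ℕ → ℕ → ℕ) m n →
             shift k (λ i → anti (λ r s → F r s i) m) n ≡ anti (λ r s → shift k (F r s) n) m
shift-anti k F zero    n = refl
shift-anti k F (suc m) n = trans (shift-+ k (F 0 (suc m)) (λ i → anti (λ r s → F (suc r) s i) m) n)
  (cong (shift k (F 0 (suc m)) n +_) (shift-anti k (F ∘ suc) m n))

-- A monomial of degree m has some degree r in the first alphabet and the remaining degree s in the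
-- second.
hom-++ : ∀ xs ys m f n → hom (xs ++ ys) m f n ≡ anti (λ r s → hom xs r (hom ys s f) n) m
hom-++ xs       ys zero    f n = refl
hom-++ []       ys (suc m) f n =
  sym (trans (cong (hom ys (suc m) f n +_) (anti-zero m)) (ℕ.+-identityʳ _))
  where
  anti-zero : ∀ m → anti (λ _ _ → 0) m ≡ 0
  anti-zero zero    = refl
  anti-zero (suc m) = anti-zero m
hom-++ (x ∷ xs) ys (suc m) f n = begin
  hom (xs ++ ys) (suc m) f n + shift x (hom (x ∷ xs ++ ys) m f) n
    ≡⟨ cong₂ _+_ (hom-++ xs ys (suc m) f n)
         (trans (shift-cong x (hom-++ (x ∷ xs) ys m f) n)
                (shift-anti x (λ r s → hom (x ∷ xs) r (hom ys s f)) m n)) ⟩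
  hom ys (suc m) f n + anti (λ r s → hom xs (suc r) (hom ys s f) n) m +
    anti (λ r s → shift x (hom (x ∷ xs) r (hom ys s f)) n) m
    ≡⟨ ℕ.+-assoc (hom ys (suc m) f n) _ _ ⟩
  _ ≡⟨ cong (hom ys (suc m) f n +_) (anti-+ (λ r s → hom xs (suc r) (hom ys s f) n)
         (λ r s → shift x (hom (x ∷ xs) r (hom ys s f)) n) m) ⟨
  anti (λ r s → hom (x ∷ xs) r (hom ys s f) n) (suc m) ∎
  where open ≡-Reasoning

-- hom (downFrom (suc L)) r is a Gaussian binomial coefficient.  hom unfolds by one of
-- the two q-Pascal rules, and this is the other one.

hom-downFrom-1 : ∀ r f → hom (downFrom 1) r f ≗ f
hom-downFrom-1 zero    f n = refl
hom-downFrom-1 (suc r) f n = hom-downFrom-1 r f n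

q-pascal : ∀ r L f n → hom (downFrom (suc (suc L))) (suc r) f n ≡
           hom (downFrom (suc (suc L))) r f n + shift (suc r) (hom (downFrom (suc L)) (suc r) f) n
q-pascal r L f n = begin
  hom (downFrom (suc L)) (suc r) f n + shift (suc L) (hom (downFrom (suc (suc L))) r f) n
    -- The first summand is expanded by this same rule for a smaller L, the second by it for a
    -- smaller r. The four terms regroup into expansions by the defining rule. At the boundary,
    -- where no smaller instance exists, `a` and `b` are 0.
    ≡⟨ cong₂ _+_ (split-L L) (split-r r) ⟩
  (β + a L) + (b r + shift (suc L + r) (hom (downFrom (suc L)) r f) n)
    ≡⟨ interchange β (a L) (b r) _ ⟩
  (β + b r) + (a L + shift (suc L + r) (hom (downFrom (suc L)) r f) n)
    ≡⟨ cong₂ _+_ (join-r r) (join-L L) ⟨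
  hom (downFrom (suc (suc L))) r f n + shift (suc r) (hom (downFrom (suc L)) (suc r) f) n ∎
  where
  open ≡-Reasoning
  β = hom (downFrom (suc L)) r f n
  a : ℕ → ℕ
  a zero    = 0
  a (suc L) = shift (suc r) (hom (downFrom (suc L)) (suc r) f) n
  b : ℕ → ℕ
  b zero    = 0
  b (suc r) = shift (suc L) (hom (downFrom (suc (suc L))) r f) n
  split-L : ∀ L → hom (downFrom (suc L)) (suc r) f n ≡ hom (downFrom (suc L)) r f n + a L
  split-L zero    = sym (ℕ.+-identityʳ _)
  split-L (suc L) = q-pascal r L f n
  split-r : ∀ r → shift (suc L) (hom (downFrom (suc (suc L))) r f) n ≡
            b r + shift (suc L + r) (hom (downFrom (suc L)) r f) n
  split-r zero    = cong (λ k → shift k f n) (sym (ℕ.+-identityʳ (suc L)))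
  split-r (suc r) = begin
    shift (suc L) (hom (downFrom (suc (suc L))) (suc r) f) n
      ≡⟨ shift-cong (suc L) (q-pascal r L f) n ⟩
    shift (suc L) (λ i → hom (downFrom (suc (suc L))) r f i +
                         shift (suc r) (hom (downFrom (suc L)) (suc r) f) i) n
      ≡⟨ shift-+ (suc L) (hom (downFrom (suc (suc L))) r f) _ n ⟩
    b (suc r) + shift (suc L) (shift (suc r) (hom (downFrom (suc L)) (suc r) f)) n
      ≡⟨ cong (b (suc r) +_) (shift-∘ (suc L) (suc r) (hom (downFrom (suc L)) (suc r) f) n) ⟩
    b (suc r) + shift (suc L + suc r) (hom (downFrom (suc L)) (suc r) f) n ∎
  join-r : ∀ r → hom (downFrom (suc (suc L))) r f n ≡ hom (downFrom (suc L)) r f n + b r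
  join-r zero    = sym (ℕ.+-identityʳ (f n))
  join-r (suc r) = refl
  join-L : ∀ L → shift (suc r) (hom (downFrom (suc L)) (suc r) f) n ≡
           a L + shift (suc L + r) (hom (downFrom (suc L)) r f) n
  join-L zero    = refl
  join-L (suc L) = begin
    shift (suc r) (λ i → hom (downFrom (suc L)) (suc r) f i +
                         shift (suc L) (hom (downFrom (suc (suc L))) r f) i) n
      ≡⟨ shift-+ (suc r) (hom (downFrom (suc L)) (suc r) f) _ n ⟩
    a (suc L) + shift (suc r) (shift (suc L) (hom (downFrom (suc (suc L))) r f)) n
      ≡⟨ cong (a (suc L) +_) (shift-∘ (suc r) (suc L) (hom (downFrom (suc (suc L))) r f) n) ⟩
    a (suc L) + shift (suc r + suc L) (hom (downFrom (suc (suc L))) r f) n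
      ≡⟨ cong (λ k → a (suc L) + shift k (hom (downFrom (suc (suc L))) r f) n) (index r L) ⟩
    a (suc L) + shift (suc (suc L) + r) (hom (downFrom (suc (suc L))) r f) n ∎
    where
    index : ∀ r L → suc r + suc L ≡ suc (suc L) + r
    index = solve-∀

-- The symmetry of Gaussian binomials: exchanging r and L turns one q-Pascal rule into the other.
hom-conjugate : ∀ r L f → hom (downFrom (suc L)) r f ≗ hom (downFrom (suc r)) L f
hom-conjugate zero    L       f n = sym (hom-downFrom-1 L f n)
hom-conjugate (suc r) zero    f n = hom-downFrom-1 (suc r) f n
hom-conjugate (suc r) (suc L) f n = trans
  (cong₂ _+_ (hom-conjugate (suc r) L f n) (shift-cong (suc L) (hom-conjugate r (suc L) f) n))
  (sym (q-pascal L r f n))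

-- The inequality between Gaussian binomials

-- The variable q⁰ is 1, and multiplication by it embeds the monomials of degree m into those of
-- degree m + 1.
hom-mono-degree : ∀ {xs} → 0 ∈ xs → ∀ m f n → hom xs m f n ℕ.≤ hom xs (suc m) f n
hom-mono-degree {xs} 0∈xs m f n with ys , zs , refl ← ∈-∃++ 0∈xs =
  subst₂ ℕ._≤_ (sym (hom-↭ (↭-shift 0 ys zs) m f n)) (sym (hom-↭ (↭-shift 0 ys zs) (suc m) f n))
    (ℕ.m≤n+m _ _)

-- Unfolding degree m + 1 at t and then at t′ gives h(xs) in degree m + 1, plus q^t′ h(t′,xs) and
-- q^t h(ys) in degree m. The first is discarded and the last cancels. What remains is q^t′ times
-- the estimate `drop-t`, which unfolds h(ys) at t and raises the degree of the second part by
-- `hom-mono-degree`.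
hom-two-exponents : ∀ t t′ {xs} → 0 ∈ t ∷ t′ ∷ xs → ∀ m f n →
  let ys = t ∷ t′ ∷ xs in
  shift t (hom ys m f) n + shift t′ (hom ys m f) n ℕ.≤
  hom ys (suc m) f n + shift (t + t′) (hom ys m f) n
hom-two-exponents t t′ {xs} 0∈ys m f n = begin
  shift t (hom ys m f) n + shift t′ (hom ys m f) n
    ≤⟨ ℕ.+-monoʳ-≤ (shift t (hom ys m f) n) bound ⟩
  shift t (hom ys m f) n + (shift t′ (hom (t′ ∷ xs) m f) n + shift (t + t′) (hom ys m f) n)
    ≤⟨ ℕ.m≤n+m _ (hom xs (suc m) f n) ⟩
  hom xs (suc m) f n +
    (shift t (hom ys m f) n + (shift t′ (hom (t′ ∷ xs) m f) n + shift (t + t′) (hom ys m f) n))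
    ≡⟨ rearrange (hom xs (suc m) f n) (shift t (hom ys m f) n) (shift t′ (hom (t′ ∷ xs) m f) n) _ ⟩
  hom ys (suc m) f n + shift (t + t′) (hom ys m f) n ∎
  where
  open ℕ.≤-Reasoning
  ys = t ∷ t′ ∷ xs
  rearrange : ∀ p q r s → p + (q + (r + s)) ≡ p + r + q + s
  rearrange = solve-∀
  drop-t : ∀ m n → hom ys m f n ℕ.≤ hom (t′ ∷ xs) m f n + shift t (hom ys m f) n
  drop-t zero    n = ℕ.m≤m+n (f n) _
  drop-t (suc m) n = ℕ.+-monoʳ-≤ (hom (t′ ∷ xs) (suc m) f n)
    (shift-mono t (hom-mono-degree 0∈ys m f) n)
  bound : shift t′ (hom ys m f) n ℕ.≤ shift t′ (hom (t′ ∷ xs) m f) n + shift (t + t′) (hom ys m f) n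
  bound = begin
    shift t′ (hom ys m f) n
      ≤⟨ shift-mono t′ (drop-t m) n ⟩
    shift t′ (λ i → hom (t′ ∷ xs) m f i + shift t (hom ys m f) i) n
      ≡⟨ shift-+ t′ (hom (t′ ∷ xs) m f) _ n ⟩
    shift t′ (hom (t′ ∷ xs) m f) n + shift t′ (shift t (hom ys m f)) n
      ≡⟨ cong (shift t′ (hom (t′ ∷ xs) m f) n +_)
           (trans (shift-comm t′ t (hom ys m f) n) (shift-∘ t t′ (hom ys m f) n)) ⟩
    shift t′ (hom (t′ ∷ xs) m f) n + shift (t + t′) (hom ys m f) n ∎

∈-extract : ∀ {x : ℕ} {xs} → x ∈ xs → ∃ λ ys → xs ↭ x ∷ ys
∈-extract x∈xs with ys , zs , refl ← ∈-∃++ x∈xs = ys ++ zs , ↭-shift _ ys zs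

-- Brings two exponents to the front, where `hom` unfolds. If they were equal, a single occurrence
-- could witness both memberships.
∈-extract₂ : ∀ {x y : ℕ} {xs} → x ≢ y → x ∈ xs → y ∈ xs → ∃ λ ys → xs ↭ x ∷ y ∷ ys
∈-extract₂ x≢y x∈xs y∈xs with ∈-extract x∈xs
... | ys , xs↭x∷ys with ∈-resp-↭ xs↭x∷ys y∈xs
...   | here y≡x = contradiction (sym y≡x) x≢y
...   | there y∈ys with zs , ys↭y∷zs ← ∈-extract y∈ys =
  zs , ↭-trans xs↭x∷ys (↭.prep _ ys↭y∷zs)

-- Conjugation turns r into a bound on the alphabet and L into the degree.

gaussian-inequality : ∀ L {r t t′} → t < t′ → t′ ℕ.≤ r → ∀ f n →
  let W = hom (downFrom L) r f in
  shift t W n + shift t′ W n ℕ.≤ hom (downFrom (suc L)) r f n + shift (t + t′) W n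
-- Without variables only degree 0 is nonzero, and r ≥ t′ > 0, so `W` vanishes.
gaussian-inequality zero {r} {t} {t′} t<t′ t′≤r f n =
  ℕ.≤-trans (ℕ.≤-reflexive zero-lhs) z≤n
  where
  W≡0 : ∀ {r} → 1 ℕ.≤ r → ∀ n → hom [] r f n ≡ 0
  W≡0 (s≤s _) n = refl
  shift-W≡0 : ∀ k → shift k (hom [] r f) n ≡ 0
  shift-W≡0 k = trans (shift-cong k (W≡0 (ℕ.≤-trans (ℕ.≤-<-trans z≤n t<t′) t′≤r)) n) (shift-0 k n)
  zero-lhs : shift t (hom [] r f) n + shift t′ (hom [] r f) n ≡ 0
  zero-lhs = cong₂ _+_ (shift-W≡0 t) (shift-W≡0 t′)
gaussian-inequality (suc L) {r} {t} {t′} t<t′ t′≤r f n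
  with xs , R↭ ← ∈-extract₂ (ℕ.<⇒≢ t<t′)
                   (∈-downFrom⁺ (s≤s (ℕ.≤-trans (ℕ.<⇒≤ t<t′) t′≤r))) (∈-downFrom⁺ (s≤s t′≤r)) =
  subst₂ ℕ._≤_ (cong₂ _+_ (shift-cong t W n) (shift-cong t′ W n))
    (cong₂ _+_ (conjugate (suc L) n) (shift-cong (t + t′) W n))
    (hom-two-exponents t t′ (∈-resp-↭ R↭ (∈-downFrom⁺ (s≤s z≤n))) L f n)
  where
  conjugate : ∀ L → hom (t ∷ t′ ∷ xs) L f ≗ hom (downFrom (suc L)) r f
  conjugate L n = trans (sym (hom-↭ R↭ L f n)) (sym (hom-conjugate r L f n))
  W : hom (t ∷ t′ ∷ xs) L f ≗ hom (downFrom (suc L)) r f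
  W = conjugate L

-- Exponents in a fixed residue class modulo M

-- The power series 1, so that `shift k δ` is qᵏ.
δ : ℕ → ℕ
δ zero    = 1
δ (suc _) = 0

-- The exponents of q in the factors of (zq^e;q^M)_L, the last factor first.
progression : ℕ → ℕ → ℕ → List ℕ
progression M e L = map (λ j → j * M + e) (downFrom L)

shift-δ-≢ : ∀ k n → n ≢ k → shift k δ n ≡ 0
shift-δ-≢ zero    zero    n≢k = contradiction refl n≢k
shift-δ-≢ zero    (suc n) n≢k = refl
shift-δ-≢ (suc k) zero    n≢k = refl
shift-δ-≢ (suc k) (suc n) n≢k = shift-δ-≢ k n (n≢k ∘ cong suc)

hom-cons-≤ : ∀ x xs m f n → hom xs m f n ℕ.≤ hom (x ∷ xs) m f n
hom-cons-≤ x xs zero    f n = ℕ.≤-refl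
hom-cons-≤ x xs (suc m) f n = ℕ.m≤m+n _ _

-- Serves both claims: ε is 0 for the first and M/2 for the second.
module ResidueClass {M ε : ℕ} (ε<M : ε < M) where

  sample : (ℕ → ℕ) → ℕ → ℕ
  sample f n = f (n * M + ε)

  InClass : ℕ → Set
  InClass k = ∃ λ x → k ≡ x * M + ε

  sample-shift : ∀ j f → sample (shift (j * M) f) ≗ shift j (sample f)
  sample-shift zero    f n       = refl
  -- The sampled exponent is ε, which lies below any shift by a positive multiple of M.
  sample-shift (suc j) f zero    = shift-< f (ℕ.<-≤-trans ε<M (ℕ.m≤m+n M (j * M)))
  sample-shift (suc j) f (suc n) = begin
    shift (M + j * M) f (M + n * M + ε)   ≡⟨ cong (shift (M + j * M) f) (ℕ.+-assoc M (n * M) ε) ⟩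
    shift (M + j * M) f (M + (n * M + ε)) ≡⟨ shift-cancel M (j * M) f (n * M + ε) ⟩
    shift (j * M) f (n * M + ε)           ≡⟨ sample-shift j f n ⟩
    shift j (sample f) n                  ∎
    where open ≡-Reasoning

  -- Each monomial of degree m in the powers q^(jM+e) is q^(me) times a monomial in the powers
  -- q^(jM); sampling turns q^M into q.
  sample-hom : ∀ e js m f → sample (hom (map (λ j → j * M + e) js) m f) ≗
               hom js m (sample (shift (m * e) f))
  sample-hom e js       zero    f n = refl
  sample-hom e []       (suc m) f n = refl
  sample-hom e (j ∷ js) (suc m) f n = cong₂ _+_ (sample-hom e js (suc m) f n) (begin
    sample (shift (j * M + e) (hom ks m f)) n
      ≡⟨ shift-∘ (j * M) e (hom ks m f) (n * M + ε) ⟨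
    sample (shift (j * M) (shift e (hom ks m f))) n
      ≡⟨ sample-shift j (shift e (hom ks m f)) n ⟩
    shift j (sample (shift e (hom ks m f))) n
      ≡⟨ shift-cong j (λ i → hom-shift ks m e f (i * M + ε)) n ⟨
    shift j (sample (hom ks m (shift e f))) n
      ≡⟨ shift-cong j (sample-hom e (j ∷ js) m (shift e f)) n ⟩
    shift j (hom (j ∷ js) m (sample (shift (m * e) (shift e f)))) n
      ≡⟨ shift-cong j (hom-cong (j ∷ js) m (λ i → trans (shift-∘ (m * e) e f (i * M + ε))
           (cong (λ k → shift k f (i * M + ε)) (ℕ.+-comm (m * e) e)))) n ⟩
    shift j (hom (j ∷ js) m (sample (shift (suc m * e) f))) n ∎)
    where
    open ≡-Reasoning
    ks = map (λ j → j * M + e) (j ∷ js)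

  -- The part of qᵏ in the residue class: it is qˣ if k = xM + ε, and 0 if k has no such form.
  point : ℕ → ℕ → ℕ
  point k = sample (shift k δ)

  point-InClass : ∀ s x → point (s * M + (x * M + ε)) ≗ shift (s + x) (point ε)
  point-InClass s x n = begin
    shift (s * M + (x * M + ε)) δ (n * M + ε)
      ≡⟨ cong (λ k → shift k δ (n * M + ε)) (regroup s x M ε) ⟩
    shift ((s + x) * M + ε) δ (n * M + ε)
      ≡⟨ shift-∘ ((s + x) * M) ε δ (n * M + ε) ⟨
    sample (shift ((s + x) * M) (shift ε δ)) n
      ≡⟨ sample-shift (s + x) (shift ε δ) n ⟩
    shift (s + x) (point ε) n ∎
    where
    open ≡-Reasoning
    regroup : ∀ s x M ε → s * M + (x * M + ε) ≡ (s + x) * M + ε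
    regroup = solve-∀

  point-¬InClass : ∀ s {k} → ¬ InClass k → ∀ n → point (s * M + k) n ≡ 0
  point-¬InClass s {k} k∉ n = begin
    shift (s * M + k) δ (n * M + ε)          ≡⟨ shift-∘ (s * M) k δ (n * M + ε) ⟨
    sample (shift (s * M) (shift k δ)) n     ≡⟨ sample-shift s (shift k δ) n ⟩
    shift s (point k) n
      ≡⟨ shift-cong s (λ i → shift-δ-≢ k _ (λ eq → k∉ (i , sym eq))) n ⟩
    shift s (λ _ → 0) n                      ≡⟨ shift-0 s n ⟩
    0                                        ∎
    where open ≡-Reasoning

  -- The contribution to the coefficient of zʳ⁺ˢ q^(nM+ε) of the products of r factors
  -- zq^(jM+e), j < K, and s factors zq^(jM+M-e), j < L.

  count : (K L e r s : ℕ) → ℕ → ℕ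
  count K L e r s = hom (downFrom K) r (hom (downFrom L) s (point (s * (M ∸ e) + r * e)))

  -- The degree is divided between the two progressions by `hom-++`, and `sample-hom` is then
  -- applied to each, which collects the exponents re and s(M - e).
  sample-progressions : ∀ K L e m n →
    hom (progression M e K ++ progression M (M ∸ e) L) m δ (n * M + ε) ≡
    anti (λ r s → count K L e r s n) m
  sample-progressions K L e m n =
    trans (hom-++ (progression M e K) (progression M (M ∸ e) L) m δ (n * M + ε)) (anti-cong split m)
    where
    open ≡-Reasoning
    xs = progression M e K
    ys = progression M (M ∸ e) L
    split : ∀ r s → hom xs r (hom ys s δ) (n * M + ε) ≡ count K L e r s n
    split r s = begin
      hom xs r (hom ys s δ) (n * M + ε)
        ≡⟨ sample-hom e (downFrom K) r (hom ys s δ) n ⟩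
      hom (downFrom K) r (sample (shift (r * e) (hom ys s δ))) n
        ≡⟨ hom-cong (downFrom K) r (λ i → hom-shift ys s (r * e) δ (i * M + ε)) n ⟨
      hom (downFrom K) r (sample (hom ys s (shift (r * e) δ))) n
        ≡⟨ hom-cong (downFrom K) r (sample-hom (M ∸ e) (downFrom L) s (shift (r * e) δ)) n ⟩
      hom (downFrom K) r (hom (downFrom L) s (sample (shift (s * (M ∸ e)) (shift (r * e) δ)))) n
        ≡⟨ hom-cong (downFrom K) r (hom-cong (downFrom L) s
             (λ i → shift-∘ (s * (M ∸ e)) (r * e) δ (i * M + ε))) n ⟩
      count K L e r s n ∎

  count-point : ∀ K L e r s {k} {f : ℕ → ℕ} → s * (M ∸ e) + r * e ≡ k → point k ≗ f →
                count K L e r s ≗ hom (downFrom K) r (hom (downFrom L) s f)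
  count-point K L e r s refl eq = hom-cong (downFrom K) r (hom-cong (downFrom L) s eq)

  count-zero : ∀ K L e r s {k} → s * (M ∸ e) + r * e ≡ k → (∀ n → point k n ≡ 0) → ∀ n →
               count K L e r s n ≡ 0
  count-zero K L e r s eq zeros n = begin
    count K L e r s n                                           ≡⟨ count-point K L e r s eq zeros n ⟩
    hom (downFrom K) r (hom (downFrom L) s (λ _ → 0)) n ≡⟨ hom-cong (downFrom K) r (hom-0 (downFrom L) s) n ⟩
    hom (downFrom K) r (λ _ → 0) n                              ≡⟨ hom-0 (downFrom K) r n ⟩
    0                                                           ∎
    where open ≡-Reasoning

  -- A factor of each kind together contribute e + (M - e) = M, so modulo M only the D surplus
  -- factors count.
  weight : ∀ {e} → e ℕ.≤ M → ∀ s D → s * (M ∸ e) + (s + D) * e ≡ s * M + D * e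
  weight {e} e≤M s D =
    trans (lemma s D e (M ∸ e)) (cong (λ k → s * k + D * e) (ℕ.m∸n+n≡m e≤M))
    where
    lemma : ∀ s D e e′ → s * e′ + (s + D) * e ≡ s * (e′ + e) + D * e
    lemma = solve-∀

  weight-swapped : ∀ {e} → e ℕ.≤ M → ∀ s D → (s + D) * (M ∸ e) + s * e ≡ s * M + D * (M ∸ e)
  weight-swapped {e} e≤M s D =
    trans (lemma s D e (M ∸ e)) (cong (λ k → s * k + D * (M ∸ e)) (ℕ.m∸n+n≡m e≤M))
    where
    lemma : ∀ s D e e′ → (s + D) * e′ + s * e ≡ s * (e′ + e) + D * e′
    lemma = solve-∀

  module _ (L s D x t t′ : ℕ) where
    private
      W : ℕ → ℕ
      W = hom (downFrom L) (s + D) (hom (downFrom L) s (shift (s + x) (point ε)))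

    -- Powers of q pass through both operators, which isolates how a count depends on its quotient x
    -- + u.
    hom-hom-shift : ∀ u →
      hom (downFrom L) (s + D) (hom (downFrom L) s (shift (s + (x + u)) (point ε))) ≗ shift u W
    hom-hom-shift u n = begin
      hom (downFrom L) (s + D) (hom (downFrom L) s (shift (s + (x + u)) (point ε))) n
        ≡⟨ hom-cong (downFrom L) (s + D) (hom-cong (downFrom L) s (λ i →
             trans (cong (λ k → shift k (point ε) i) (regroup s x u))
                   (sym (shift-∘ u (s + x) (point ε) i)))) n ⟩
      hom (downFrom L) (s + D) (hom (downFrom L) s (shift u (shift (s + x) (point ε)))) n
        ≡⟨ hom-cong (downFrom L) (s + D) (hom-shift (downFrom L) s u (shift (s + x) (point ε))) n ⟩
      hom (downFrom L) (s + D) (shift u (hom (downFrom L) s (shift (s + x) (point ε)))) n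
        ≡⟨ hom-shift (downFrom L) (s + D) u (hom (downFrom L) s (shift (s + x) (point ε))) n ⟩
      shift u W n ∎
      where
      open ≡-Reasoning
      regroup : ∀ s x u → s + (x + u) ≡ u + (s + x)
      regroup = solve-∀

    -- The counts for b are q^t W and q^t′ W. Of those for a, the first is the larger Gaussian
    -- binomial of `gaussian-inequality` with r = s + D, and the second is at least q^(t+t′) W,
    -- because omitting its extra variable q^L can only decrease it.
    count-inequality-InClass : ∀ {a b} → a ℕ.≤ M → b ℕ.≤ M → t < t′ → t′ ℕ.≤ s + D →
      D * a ≡ x * M + ε → D * b ≡ (x + t) * M + ε →
      D * (M ∸ b) ≡ (x + t′) * M + ε → D * (M ∸ a) ≡ (x + (t + t′)) * M + ε → ∀ n →
      count L L b (s + D) s n + count L L b s (s + D) n ℕ.≤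
      count (suc L) L a (s + D) s n + count (suc L) L a s (s + D) n
    count-inequality-InClass {a} {b} a≤M b≤M t<t′ t′≤r Da Db Db′ Da′ n = begin
      count L L b (s + D) s n + count L L b s (s + D) n
        ≡⟨ cong₂ _+_
             (trans (count-point L L b (s + D) s (trans (weight b≤M s D) (cong (s * M +_) Db))
                      (point-InClass s (x + t)) n)
                    (hom-hom-shift t n))
             (trans (count-point L L b s (s + D) (trans (weight-swapped b≤M s D) (cong (s * M +_) Db′))
                      (point-InClass s (x + t′)) n)
                    (trans (hom-comm (downFrom L) (downFrom L) s (s + D) _ n) (hom-hom-shift t′ n))) ⟩
      shift t W n + shift t′ W n
        ≤⟨ gaussian-inequality L t<t′ t′≤r (hom (downFrom L) s (shift (s + x) (point ε))) n ⟩
      hom (downFrom (suc L)) (s + D) (hom (downFrom L) s (shift (s + x) (point ε))) n +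
        shift (t + t′) W n
        ≡⟨ cong₂ _+_
             (count-point (suc L) L a (s + D) s (trans (weight a≤M s D) (cong (s * M +_) Da))
               (point-InClass s x) n)
             (trans (hom-comm (downFrom L) (downFrom L) s (s + D) (shift (s + (x + (t + t′))) (point ε)) n)
                    (hom-hom-shift (t + t′) n)) ⟨
      count (suc L) L a (s + D) s n +
        hom (downFrom L) s (hom (downFrom L) (s + D) (shift (s + (x + (t + t′))) (point ε))) n
        ≤⟨ ℕ.+-monoʳ-≤ (count (suc L) L a (s + D) s n) (hom-cons-≤ L (downFrom L) s _ n) ⟩
      count (suc L) L a (s + D) s n +
        hom (downFrom (suc L)) s (hom (downFrom L) (s + D) (shift (s + (x + (t + t′))) (point ε))) n
        ≡⟨ cong (count (suc L) L a (s + D) s n +_)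
             (count-point (suc L) L a s (s + D) (trans (weight-swapped a≤M s D) (cong (s * M +_) Da′))
               (point-InClass s (x + (t + t′))) n) ⟨
      count (suc L) L a (s + D) s n + count (suc L) L a s (s + D) n ∎
      where open ℕ.≤-Reasoning

  -- With equally many factors of both kinds the residues cancel and e drops out of the exponent;
  -- the extra factor for a only adds terms.
  count-diagonal : ∀ {a b} → a ℕ.≤ M → b ℕ.≤ M → ∀ L s n →
                   count L L b s s n ℕ.≤ count (suc L) L a s s n
  count-diagonal {a} {b} a≤M b≤M L s n = begin
    count L L b s s n
      ≡⟨ count-point L L b s s (weight-diagonal b≤M) (λ _ → refl) n ⟩
    hom (downFrom L) s (hom (downFrom L) s (point (s * M))) n
      ≤⟨ hom-cons-≤ L (downFrom L) s (hom (downFrom L) s (point (s * M))) n ⟩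
    hom (downFrom (suc L)) s (hom (downFrom L) s (point (s * M))) n
      ≡⟨ count-point (suc L) L a s s (weight-diagonal a≤M) (λ _ → refl) n ⟨
    count (suc L) L a s s n ∎
    where
    open ℕ.≤-Reasoning
    weight-diagonal : ∀ {e} → e ℕ.≤ M → s * (M ∸ e) + s * e ≡ s * M
    weight-diagonal {e} e≤M = trans (sym (ℕ.*-distribˡ-+ s (M ∸ e) e)) (cong (s *_) (ℕ.m∸n+n≡m e≤M))

  -- Comparison of the quotients by M, and the resulting inequality of coefficients

  module _ {a b : ℕ} (a<b : a < b) (2b<M : 2 * b < M) where
    private
      instance
        M≢0 : NonZero M
        M≢0 = >-nonZero (ℕ.≤-<-trans z≤n 2b<M)

      b<M∸b : b < M ∸ b
      b<M∸b = ℕ.m+n≤o⇒m≤o∸n (suc b) (subst (_< M) (cong (b +_) (ℕ.+-identityʳ b)) 2b<M)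

      b≤M : b ℕ.≤ M
      b≤M = ℕ.≤-trans (ℕ.<⇒≤ b<M∸b) (ℕ.m∸n≤m M b)

      a≤M : a ℕ.≤ M
      a≤M = ℕ.≤-trans (ℕ.<⇒≤ a<b) b≤M

    -- The order comes from a < b < M - b ≤ M, multiplied by D and divided by M; the equal sums come
    -- from a + (M - a) = b + (M - b).
    quotient-relations : ∀ {D x x′ y y′} → 0 < D →
      D * a ≡ x * M + ε → D * (M ∸ a) ≡ x′ * M + ε → D * b ≡ y * M + ε → D * (M ∸ b) ≡ y′ * M + ε →
      x ℕ.≤ y × y < y′ × y′ ℕ.≤ D × x + x′ ≡ y + y′
    quotient-relations {D} {x} {x′} {y} {y′} 0<D Da Da′ Db Db′ = x≤y , y<y′ , y′≤D , sums-agree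
      where
      instance
        D≢0 : NonZero D
        D≢0 = >-nonZero 0<D
      x≤y : x ℕ.≤ y
      x≤y = ℕ.*-cancelʳ-≤ x y M (ℕ.+-cancelʳ-≤ ε (x * M) (y * M)
        (subst₂ ℕ._≤_ Da Db (ℕ.*-monoʳ-≤ D (ℕ.<⇒≤ a<b))))
      y<y′ : y < y′
      y<y′ = ℕ.*-cancelʳ-< M y y′ (ℕ.+-cancelʳ-< ε (y * M) (y′ * M)
        (subst₂ _<_ Db Db′ (ℕ.*-monoʳ-< D b<M∸b)))
      y′≤D : y′ ℕ.≤ D
      y′≤D = ℕ.*-cancelʳ-≤ y′ D M (ℕ.≤-trans (ℕ.m≤m+n (y′ * M) ε)
        (subst (ℕ._≤ D * M) Db′ (ℕ.*-monoʳ-≤ D (ℕ.m∸n≤m M b))))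
      total : ∀ e u u′ → e ℕ.≤ M → D * e ≡ u * M + ε → D * (M ∸ e) ≡ u′ * M + ε →
              (u + u′) * M + (ε + ε) ≡ D * M
      total e u u′ e≤M De De′ = begin
        (u + u′) * M + (ε + ε)         ≡⟨ lemma u u′ M ε ⟩
        (u * M + ε) + (u′ * M + ε)     ≡⟨ cong₂ _+_ De De′ ⟨
        D * e + D * (M ∸ e)            ≡⟨ ℕ.*-distribˡ-+ D e (M ∸ e) ⟨
        D * (e + (M ∸ e))              ≡⟨ cong (D *_) (ℕ.m+[n∸m]≡n e≤M) ⟩
        D * M                          ∎
        where
        open ≡-Reasoning
        lemma : ∀ u u′ M ε → (u + u′) * M + (ε + ε) ≡ (u * M + ε) + (u′ * M + ε)
        lemma = solve-∀
      sums-agree : x + x′ ≡ y + y′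
      sums-agree = ℕ.*-cancelʳ-≡ (x + x′) (y + y′) M (ℕ.+-cancelʳ-≡ (ε + ε) _ _
        (trans (total a x x′ a≤M Da Da′) (sym (total b y y′ b≤M Db Db′))))

    -- Measuring all quotients from the smallest one gives the offsets 0, t, t′ and t + t′; the last
    -- is forced by the equal sums, and t′ ≤ y′ ≤ D.
    quotients : ∀ {D x x′ y y′} → 0 < D →
      D * a ≡ x * M + ε → D * (M ∸ a) ≡ x′ * M + ε → D * b ≡ y * M + ε → D * (M ∸ b) ≡ y′ * M + ε →
      ∃₂ λ t t′ → t < t′ × t′ ℕ.≤ D × y ≡ x + t × y′ ≡ x + t′ × x′ ≡ x + (t + t′)
    quotients {D} {x} {x′} {y} {y′} 0<D Da Da′ Db Db′
      with x≤y , y<y′ , y′≤D , sums-agree ← quotient-relations {D} {x} {x′} {y} {y′} 0<D Da Da′ Db Db′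
      with t , refl ← ℕ.m≤n⇒∃[o]m+o≡n x≤y
      with t′ , refl ← ℕ.m≤n⇒∃[o]m+o≡n (ℕ.≤-trans x≤y (ℕ.<⇒≤ y<y′)) =
      t , t′ , ℕ.+-cancelˡ-< x t t′ y<y′ , ℕ.≤-trans (ℕ.m≤n+m t′ x) y′≤D , refl , refl ,
      ℕ.+-cancelˡ-≡ x _ _ (trans sums-agree (regroup x t t′))
      where
      regroup : ∀ x t t′ → (x + t) + (x + t′) ≡ x + (x + (t + t′))
      regroup = solve-∀

    -- The assumption gathers what the comparison needs about residue classes; coprimality of b and
    -- M enters through it.
    module _ (dichotomy : ∀ D →
               (InClass (D * a) × InClass (D * (M ∸ a)) × InClass (D * b) × InClass (D * (M ∸ b))) ⊎
               (¬ InClass (D * b) × ¬ InClass (D * (M ∸ b)))) where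

      count-inequality : ∀ L s D n →
        count L L b (s + D) s n + count L L b s (s + D) n ℕ.≤
        count (suc L) L a (s + D) s n + count (suc L) L a s (s + D) n
      count-inequality L s zero n rewrite ℕ.+-identityʳ s =
        ℕ.+-mono-≤ (count-diagonal a≤M b≤M L s n) (count-diagonal a≤M b≤M L s n)
      count-inequality L s D@(suc _) n with dichotomy D
      ... | inj₁ ((x , Da) , (x′ , Da′) , (y , Db) , (y′ , Db′))
        with t , t′ , t<t′ , t′≤D , refl , refl , refl ←
               quotients {D} {x} {x′} {y} {y′} (s≤s z≤n) Da Da′ Db Db′ =
        count-inequality-InClass L s D x t t′ a≤M b≤M t<t′
          (ℕ.≤-trans t′≤D (ℕ.m≤n+m D s)) Da Db Db′ Da′ n
      ... | inj₂ (Db∉ , Db′∉) = ℕ.≤-trans (ℕ.≤-reflexive (cong₂ _+_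
        (count-zero L L b (s + D) s (weight b≤M s D) (point-¬InClass s Db∉) n)
        (count-zero L L b s (s + D) (weight-swapped b≤M s D) (point-¬InClass s Db′∉) n))) z≤n

      progression-inequality : ∀ L m n →
        hom (progression M b L ++ progression M (M ∸ b) L) m δ (n * M + ε) ℕ.≤
        hom (progression M a (suc L) ++ progression M (M ∸ a) L) m δ (n * M + ε)
      progression-inequality L m n = subst₂ ℕ._≤_
        (sym (sample-progressions L L b m n)) (sym (sample-progressions (suc L) L a m n))
        (anti-mono-symmetrised pairs m)
        where
        pairs : ∀ r s → count L L b r s n + count L L b s r n ℕ.≤
                        count (suc L) L a r s n + count (suc L) L a s r n
        pairs r s with ℕ.≤-total s r
        ... | inj₁ s≤r with D , refl ← ℕ.m≤n⇒∃[o]m+o≡n s≤r = count-inequality L s D n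
        ... | inj₂ r≤s with D , refl ← ℕ.m≤n⇒∃[o]m+o≡n r≤s = subst₂ ℕ._≤_
          (ℕ.+-comm (count L L b (r + D) r n) _) (ℕ.+-comm (count (suc L) L a (r + D) r n) _)
          (count-inequality L r D n)

-- Expansion of the reciprocals

-- The generating function of the complete homogeneous polynomials, that is, the product of 1/(1 -
-- zqˣ) over x in `xs`.
homSeries : List ℕ → Series
homSeries xs m n = ℤ.+ hom xs m δ n

q-monomial-⊛ : ∀ s (g : ℕ → ℕ → ℕ) m n → (z^ 0 q^ s ⊛ λ i j → ℤ.+ g i j) m n ≡ ℤ.+ shift s (g m) n
q-monomial-⊛ zero    g m n       = ⊛-identityˡ (λ i j → ℤ.+ g i j) m n
q-monomial-⊛ (suc s) g m zero    = monomial-suc-q-⊛ 0 s (λ i j → ℤ.+ g i j) m zero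
q-monomial-⊛ (suc s) g m (suc n) =
  trans (monomial-suc-q-⊛ 0 s (λ i j → ℤ.+ g i j) m (suc n)) (q-monomial-⊛ s g m n)

-- The recursion of `hom` says that the series of s ∷ xs is that of xs plus zqˢ times itself.
linear-⊛ : ∀ s xs → (𝟙 ⊖ z^ 1 q^ s) ⊛ homSeries (s ∷ xs) ≈ homSeries xs
linear-⊛ s xs m n = begin
  ((𝟙 ⊖ z^ 1 q^ s) ⊛ homSeries (s ∷ xs)) m n
    ≡⟨ ⊛-distribʳ-⊖ 𝟙 (z^ 1 q^ s) (homSeries (s ∷ xs)) m n ⟩
  (𝟙 ⊛ homSeries (s ∷ xs)) m n ℤ.- (z^ 1 q^ s ⊛ homSeries (s ∷ xs)) m n
    ≡⟨ cong₂ ℤ._-_ (⊛-identityˡ (homSeries (s ∷ xs)) m n)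
                   (monomial-suc-z-⊛ 0 s (homSeries (s ∷ xs)) m n) ⟩
  homSeries (s ∷ xs) m n ℤ.- z· (z^ 0 q^ s ⊛ homSeries (s ∷ xs)) m n
    ≡⟨ remainder m ⟩
  homSeries xs m n ∎
  where
  open ≡-Reasoning
  cancel : ∀ x y → x ℤ.+ y ℤ.- y ≡ x
  cancel = ℤ-Solver.solve-∀
  remainder : ∀ m →
    homSeries (s ∷ xs) m n ℤ.- z· (z^ 0 q^ s ⊛ homSeries (s ∷ xs)) m n ≡ homSeries xs m n
  remainder zero    = ℤ.+-identityʳ _
  remainder (suc m) = trans
    (cong (λ w → ℤ.+ (hom xs (suc m) δ n + shift s (hom (s ∷ xs) m δ) n) ℤ.- w)
          (q-monomial-⊛ s (λ i → hom (s ∷ xs) i δ) m n))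
    (cancel (ℤ.+ hom xs (suc m) δ n) (ℤ.+ shift s (hom (s ∷ xs) m δ) n))

⊖-congʳ : ∀ f {g g′} → g ≈ g′ → f ⊖ g ≈ f ⊖ g′
⊖-congʳ f g≈g′ m n = cong (λ w → f m n ℤ.- w) (g≈g′ m n)

-- The last factor of `poch` has the exponent that heads `progression`, so the factors cancel one by
-- one from the right. The list `xs` leaves room for a second product.
poch-⊛ : ∀ M e L xs →
  poch (z^ 1 q^ e) (z^ 0 q^ M) L ⊛ homSeries (progression M e L ++ xs) ≈ homSeries xs
poch-⊛ M e zero    xs m n = ⊛-identityˡ (homSeries xs) m n
poch-⊛ M e (suc L) xs m n = begin
  ((poch x p L ⊛ (𝟙 ⊖ x ⊛ p ^ L)) ⊛ homSeries (L * M + e ∷ ys)) m n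
    ≡⟨ ⊛-assoc (poch x p L) (𝟙 ⊖ x ⊛ p ^ L) (homSeries (L * M + e ∷ ys)) m n ⟩
  (poch x p L ⊛ ((𝟙 ⊖ x ⊛ p ^ L) ⊛ homSeries (L * M + e ∷ ys))) m n
    ≡⟨ ⊛-congʳ (poch x p L) (λ i j → trans
         (⊛-congˡ (homSeries (L * M + e ∷ ys)) (⊖-congʳ 𝟙 factor) i j)
         (linear-⊛ (L * M + e) ys i j)) m n ⟩
  (poch x p L ⊛ homSeries ys) m n
    ≡⟨ poch-⊛ M e L xs m n ⟩
  homSeries xs m n ∎
  where
  open ≡-Reasoning
  x = z^ 1 q^ e
  p = z^ 0 q^ M
  ys = progression M e L ++ xs
  factor : x ⊛ p ^ L ≈ z^ 1 q^ (L * M + e)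
  factor i j = trans (⊛-congʳ x (q-power M L) i j) (trans (monomial-⊛ 1 e 0 (L * M) i j)
    (cong (λ k → (z^ 1 q^ k) i j) (ℕ.+-comm e (L * M))))

homSeries-[] : homSeries [] ≈ 𝟙
homSeries-[] zero    zero    = refl
homSeries-[] zero    (suc n) = refl
homSeries-[] (suc m) n       = refl

poch₂-⊛ : ∀ M e e′ L →
  poch₂ (z^ 1 q^ e) (z^ 1 q^ e′) (z^ 0 q^ M) L ⊛ homSeries (progression M e L ++ progression M e′ L) ≈ 𝟙
poch₂-⊛ M e e′ L m n = begin
  ((P ⊛ P′) ⊛ homSeries (xs ++ ys)) m n
    -- After reassociation `P′` acts first, so its exponents must head the list.
    ≡⟨ ⊛-congʳ (P ⊛ P′) (λ i j → cong ℤ.+_ (hom-↭ reorder i δ j)) m n ⟩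
  ((P ⊛ P′) ⊛ homSeries (ys ++ xs ++ [])) m n
    ≡⟨ ⊛-assoc P P′ (homSeries (ys ++ xs ++ [])) m n ⟩
  (P ⊛ (P′ ⊛ homSeries (ys ++ xs ++ []))) m n
    ≡⟨ ⊛-congʳ P (poch-⊛ M e′ L (xs ++ [])) m n ⟩
  (P ⊛ homSeries (xs ++ [])) m n
    ≡⟨ poch-⊛ M e L [] m n ⟩
  homSeries [] m n
    ≡⟨ homSeries-[] m n ⟩
  𝟙 m n ∎
  where
  open ≡-Reasoning
  P = poch (z^ 1 q^ e) (z^ 0 q^ M) L
  P′ = poch (z^ 1 q^ e′) (z^ 0 q^ M) L
  xs = progression M e L
  ys = progression M e′ L
  reorder : xs ++ ys ↭ ys ++ xs ++ []
  reorder = subst (λ zs → xs ++ ys ↭ ys ++ zs) (sym (++-identityʳ xs)) (++-comm xs ys)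

constant-term-⊛ : ∀ f g → f 0 0 ≡ 1ℤ → g 0 0 ≡ 1ℤ → (f ⊛ g) 0 0 ≡ 1ℤ
constant-term-⊛ f g f₀₀ g₀₀ rewrite f₀₀ | g₀₀ = refl

constant-term-poch : ∀ M e L → poch (z^ 1 q^ e) (z^ 0 q^ M) L 0 0 ≡ 1ℤ
constant-term-poch M e zero    = refl
constant-term-poch M e (suc L) = constant-term-⊛ (poch (z^ 1 q^ e) (z^ 0 q^ M) L)
  (𝟙 ⊖ z^ 1 q^ e ⊛ (z^ 0 q^ M) ^ L) (constant-term-poch M e L)
  (cong (λ k → 1ℤ ℤ.- k) (monomial-suc-z-⊛ 0 e ((z^ 0 q^ M) ^ L) 0 0))

constant-term-poch₂ : ∀ M e e′ L → poch₂ (z^ 1 q^ e) (z^ 1 q^ e′) (z^ 0 q^ M) L 0 0 ≡ 1ℤ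
constant-term-poch₂ M e e′ L = constant-term-⊛ (poch (z^ 1 q^ e) (z^ 0 q^ M) L)
  (poch (z^ 1 q^ e′) (z^ 0 q^ M) L) (constant-term-poch M e L) (constant-term-poch M e′ L)

1/poch₂ : ∀ M e e′ L →
  1/ poch₂ (z^ 1 q^ e) (z^ 1 q^ e′) (z^ 0 q^ M) L ≈ homSeries (progression M e L ++ progression M e′ L)
1/poch₂ M e e′ L = 1/-unique (poch₂ (z^ 1 q^ e) (z^ 1 q^ e′) (z^ 0 q^ M) L)
  (homSeries (progression M e L ++ progression M e′ L)) (constant-term-poch₂ M e e′ L) (poch₂-⊛ M e e′ L)

-- The extra factor has exponent LM + e, the next term of the first progression, whose length thus
-- becomes L + 1.
1/poch₂-linear : ∀ M e e′ L →
  1/ (poch₂ (z^ 1 q^ e) (z^ 1 q^ e′) (z^ 0 q^ M) L ⊛ (𝟙 ⊖ z^ 1 q^ (L * M + e))) ≈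
  homSeries (progression M e (suc L) ++ progression M e′ L)
1/poch₂-linear M e e′ L = 1/-unique (P ⊛ (𝟙 ⊖ z^ 1 q^ x)) (homSeries (x ∷ ys))
  (constant-term-⊛ P (𝟙 ⊖ z^ 1 q^ x) (constant-term-poch₂ M e e′ L) refl) λ i j →
  trans (⊛-assoc P (𝟙 ⊖ z^ 1 q^ x) (homSeries (x ∷ ys)) i j)
    (trans (⊛-congʳ P (linear-⊛ x ys) i j) (poch₂-⊛ M e e′ L i j))
  where
  P = poch₂ (z^ 1 q^ e) (z^ 1 q^ e′) (z^ 0 q^ M) L
  x = L * M + e
  ys = progression M e L ++ progression M e′ L

c-nonnegative : ∀ {a b M L m n} →
  hom (progression M b L ++ progression M (M ∸ b) L) m δ n ℕ.≤
  hom (progression M a (suc L) ++ progression M (M ∸ a) L) m δ n → 0ℤ ≤ c a b M L m n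
c-nonnegative {a} {b} {M} {L} {m} {n} b≤a = ℤ.i≤j⇒0≤j-i (subst₂ _≤_
  (sym (1/poch₂ M b (M ∸ b) L m n)) (sym (1/poch₂-linear M a (M ∸ a) L m n)) (ℤ.+≤+ b≤a))

-- Arithmetic of the residue classes

odd-form : ∀ {k} → ¬ 2 ∣ k → ∃ λ v → k ≡ 1 + v * 2
odd-form {k} 2∤k with k % 2 in eq | m%n<n k 2
... | 0 | _ = contradiction (m%n≡0⇒n∣m k 2 eq) 2∤k
... | 1 | _ = k / 2 , trans (m≡m%n+[m/n]*n k 2) (cong (_+ k / 2 * 2) eq)
... | suc (suc _) | s≤s (s≤s ())

∣-complement : ∀ {d e M} → e ℕ.≤ M → d ∣ M → d ∣ M ∸ e → d ∣ e
∣-complement {d} e≤M d∣M = ∣m+n∣m⇒∣n (subst (d ∣_) (sym (ℕ.m∸n+n≡m e≤M)) d∣M)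

coprime-complement : ∀ {e M} → e ℕ.≤ M → Coprime e M → Coprime (M ∸ e) M
coprime-complement e≤M e⊥M (d∣M∸e , d∣M) = e⊥M (∣-complement e≤M d∣M d∣M∸e , d∣M)

module _ {M ε : ℕ} (ε<M : ε < M) where
  open ResidueClass ε<M

  InClass? : ∀ k → Dec (InClass k)
  InClass? k = map′
    (λ eq → k / M , trans (m≡m%n+[m/n]*n k M) (trans (cong (_+ k / M * M) eq) (ℕ.+-comm ε _)))
    (λ { (x , refl) → trans (cong (_% M) (ℕ.+-comm (x * M) ε))
                            (trans ([m+kn]%n≡m%n ε x M) (m<n⇒m%n≡m ε<M)) })
    (k % M ℕ.≟ ε)
    where
    instance
      M≢0 : NonZero M
      M≢0 = >-nonZero (ℕ.≤-<-trans z≤n ε<M)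

  module _ {a b : ℕ} (a<b : a < b) (2b<M : 2 * b < M)
           (a-class  : ∀ D → InClass D → InClass (D * a))
           (a′-class : ∀ D → InClass D → InClass (D * (M ∸ a)))
           (b-class  : ∀ D → InClass D → InClass (D * b))
           (b′-class : ∀ D → InClass D → InClass (D * (M ∸ b)))
           (b-class⁻¹  : ∀ D → InClass (D * b) → InClass D)
           (b′-class⁻¹ : ∀ D → InClass (D * (M ∸ b)) → InClass D) where

    -- The alternative is decided by whether D itself lies in the class: all four multipliers
    -- preserve the class, and b and M - b also reflect it.
    c-nonnegative-InClass : ∀ L m n → 0ℤ ≤ c a b M L m (n * M + ε)
    c-nonnegative-InClass L m n =
      c-nonnegative {a} {b} {M} {L} {m} (progression-inequality a<b 2b<M dichotomy L m n)
      where
      dichotomy : ∀ D →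
        (InClass (D * a) × InClass (D * (M ∸ a)) × InClass (D * b) × InClass (D * (M ∸ b))) ⊎
        (¬ InClass (D * b) × ¬ InClass (D * (M ∸ b)))
      dichotomy D with InClass? D
      ... | yes D∈ = inj₁ (a-class D D∈ , a′-class D D∈ , b-class D D∈ , b′-class D D∈)
      ... | no D∉  = inj₂ (D∉ ∘ b-class⁻¹ D , D∉ ∘ b′-class⁻¹ D)

module MultiplesOfM {M : ℕ} (0<M : 0 < M) where
  open ResidueClass 0<M

  *-InClass : ∀ e D → InClass D → InClass (D * e)
  *-InClass e D (u , refl) = u * e , lemma u M e
    where
    lemma : ∀ u M e → (u * M + 0) * e ≡ u * e * M + 0
    lemma = solve-∀

  *-InClass⁻¹ : ∀ {e} → Coprime e M → ∀ D → InClass (D * e) → InClass D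
  *-InClass⁻¹ {e} e⊥M D (x , eq)
    with divides u D≡uM ← Coprime.coprime-divisor (Coprime.sym e⊥M)
           (divides x (trans (ℕ.*-comm e D) (trans eq (ℕ.+-identityʳ (x * M))))) =
    u , trans D≡uM (sym (ℕ.+-identityʳ (u * M)))

module OddMultiplesOfHalf {h : ℕ} (h<M : h < h * 2) where
  open ResidueClass h<M

  *-InClass : ∀ {e} → ¬ 2 ∣ e → ∀ D → InClass D → InClass (D * e)
  *-InClass 2∤e D (u , refl) with v , refl ← odd-form 2∤e = u * (1 + v * 2) + v , lemma u h v
    where
    lemma : ∀ u h v → (u * (h * 2) + h) * (1 + v * 2) ≡ (u * (1 + v * 2) + v) * (h * 2) + h
    lemma = solve-∀

  private
    instance
      h≢0 : NonZero h
      h≢0 = ℕ.≢-nonZero λ { refl → contradiction h<M λ () }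

    half-multiple : ∀ x h → x * (h * 2) + h ≡ (x * 2 + 1) * h
    half-multiple = solve-∀

    -- Cancelling h leaves ue = 2x + 1, which is odd.
    odd-multiplier : ∀ {u e} x → u * h * e ≡ x * (h * 2) + h → ¬ 2 ∣ u
    odd-multiplier {e = e} x eq (divides w refl) = contradiction
      (∣m+n∣m⇒∣n (divides (w * e) (trans (sym ue≡2x+1) (factor-2 w e))) (divides x refl))
      λ { (divides zero ()) ; (divides (suc _) ()) }
      where
      factor-h : ∀ w e h → w * 2 * e * h ≡ w * 2 * h * e
      factor-h = solve-∀
      factor-2 : ∀ w e → w * 2 * e ≡ w * e * 2
      factor-2 = solve-∀
      ue≡2x+1 : w * 2 * e ≡ x * 2 + 1
      ue≡2x+1 = ℕ.*-cancelʳ-≡ (w * 2 * e) (x * 2 + 1) h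
        (trans (factor-h w e h) (trans eq (half-multiple x h)))

  -- Since h divides De and is coprime to e, it divides D; the cofactor is odd by `odd-multiplier`,
  -- and the class consists of the odd multiples of h.
  *-InClass⁻¹ : ∀ {e} → Coprime e (h * 2) → ∀ D → InClass (D * e) → InClass D
  *-InClass⁻¹ {e} e⊥M D (x , eq)
    with divides u refl ← Coprime.coprime-divisor {h} {e} {D}
           (λ { (d∣h , d∣e) → e⊥M (d∣e , ∣-trans d∣h (m∣m*n 2)) })
           (divides (x * 2 + 1) (trans (ℕ.*-comm e D) (trans eq (half-multiple x h))))
    with v , refl ← odd-form (odd-multiplier {u} {e} x eq) = v , expand v h
    where
    expand : ∀ v h → (1 + v * 2) * h ≡ v * (h * 2) + h
    expand = solve-∀

-- Nonnegativity at the exponents nM and nM + M/2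

theorem1p2 : ∀ (a b M : ℕ) → 1 ℕ.≤ a → a < b → 2 * b < M → gcd b M ≡ 1 →
    (∀ (L m n : ℕ) → 0ℤ ≤ c a b M L m (n * M)) ×
    (2 ∣ M → ¬ (2 ∣ a) → ∀ (L m n : ℕ) → 0ℤ ≤ c a b M L m (n * M + M / 2))
theorem1p2 a b M 1≤a a<b 2b<M gcd≡1 = multiples , half
  where
  0<M : 0 < M
  0<M = ℕ.≤-<-trans z≤n 2b<M

  b≤M : b ℕ.≤ M
  b≤M = ℕ.≤-trans (ℕ.m≤m+n b _) (ℕ.<⇒≤ 2b<M)

  b⊥M : Coprime b M
  b⊥M = Coprime.gcd≡1⇒coprime gcd≡1

  b′⊥M : Coprime (M ∸ b) M
  b′⊥M = coprime-complement b≤M b⊥M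

  multiples : ∀ L m n → 0ℤ ≤ c a b M L m (n * M)
  multiples L m n = subst (λ k → 0ℤ ≤ c a b M L m k) (ℕ.+-identityʳ (n * M))
    (c-nonnegative-InClass 0<M a<b 2b<M (*-InClass a) (*-InClass (M ∸ a))
      (*-InClass b) (*-InClass (M ∸ b))
      (*-InClass⁻¹ b⊥M) (*-InClass⁻¹ b′⊥M) L m n)
    where open MultiplesOfM 0<M

  half : 2 ∣ M → ¬ (2 ∣ a) → ∀ L m n → 0ℤ ≤ c a b M L m (n * M + M / 2)
  -- With M written as h * 2, all four multipliers are odd: a by assumption, M - a because M is
  -- even, and b and M - b because they are coprime to M.
  half 2∣M@(divides h refl) 2∤a L m n = subst (λ k → 0ℤ ≤ c a b M L m (n * M + k)) (sym (m*n/n≡m h 2))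
    (c-nonnegative-InClass h<M a<b 2b<M (*-InClass 2∤a) (*-InClass (2∤a ∘ ∣-complement a≤M 2∣M))
      (*-InClass (2∤ b⊥M)) (*-InClass (2∤ b′⊥M)) (*-InClass⁻¹ b⊥M) (*-InClass⁻¹ b′⊥M) L m n)
    where
    h<M : h < h * 2
    h<M = ℕ.m<m*n h 2 {{ℕ.≢-nonZero λ { refl → contradiction 0<M λ () }}} (s≤s (s≤s z≤n))
    open OddMultiplesOfHalf h<M
    a≤M : a ℕ.≤ M
    a≤M = ℕ.≤-trans (ℕ.<⇒≤ a<b) b≤M
    2∤ : ∀ {e} → Coprime e M → ¬ 2 ∣ e
    2∤ e⊥M 2∣e with () ← e⊥M (2∣e , 2∣M)
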